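{- Let $v$ be a positive integer with $v\notin\{47,49,59\}$. Then every strongly admissible multiset of size $v-1$ with support $\{1,6,18\}$ is realizable.
   Context: $K_v$ is the complete graph on vertex set $\{0,\dots,v-1\}$; the length of an edge $\{u,w\}$ is $\min(|u-w|,v-|u-w|)$. A multiset $L$ of size $v-1$ is realizable if some Hamiltonian path in $K_v$ has multiset of edge lengths equal to $L$. The support $\mathrm{supp}(L)$ is the set of distinct elements of $L$. $L$ of size $v-1$ is strongly admissible if $\mathrm{supp}(L)\subseteq\{1,\dots,\lfloor v/2\rfloor\}$ and $\gcd(v,z)=1$ for every $z\in L$. -}

module Defs where

open import Data.Nat using (ℕ; zero; suc; _∸_; _≤_; _/_; ∣_-_∣; _⊓_)
open import Data.Nat.GCD using (gcd)
open import Data.List using (List; []; _∷_; length; upTo)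
open import Data.List.Membership.Propositional using (_∈_)
open import Data.List.Relation.Binary.Permutation.Propositional using (_↭_)
open import Data.Product using (∃; _×_)
open import Relation.Binary.PropositionalEquality using (_≡_)

edgeLength : ℕ → ℕ → ℕ → ℕ
edgeLength v u w = ∣ u - w ∣ ⊓ (v ∸ ∣ u - w ∣)

pathLengths : ℕ → List ℕ → List ℕ
pathLengths v []            = []
pathLengths v (x ∷ [])      = []
pathLengths v (x ∷ y ∷ xs)  = edgeLength v x y ∷ pathLengths v (y ∷ xs)

IsHamiltonianPath : ℕ → List ℕ → Set
IsHamiltonianPath v p = p ↭ upTo v

-- multisets are lists considered up to permutation
Realizable : ℕ → List ℕ → Set
Realizable v L = ∃ λ p → IsHamiltonianPath v p × pathLengths v p ↭ L

StronglyAdmissible : ℕ → List ℕ → Set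
StronglyAdmissible v L =
  length L ≡ v ∸ 1 ×
  (∀ z → z ∈ L → 1 ≤ z × z ≤ v / 2) ×
  (∀ z → z ∈ L → gcd v z ≡ 1)

SupportIs3 : List ℕ → ℕ → ℕ → ℕ → Set
SupportIs3 L a b c =
  (∀ z → z ∈ L → z ≡ a Data.Sum.⊎ z ≡ b Data.Sum.⊎ z ≡ c) × (a ∈ L × b ∈ L × c ∈ L)
  where import Data.Sum

{-# OPTIONS --safe #-}
-- Label the edges of a Hamiltonian path in K_v by arcs of length 1, 6 or 18 on the cycle
-- ℤ/v, and cut the cycle between the vertices m − 1 and m.  Inserting x new vertices there
-- lengthens by x exactly the arcs crossing the cut; if the new vertices can be matched with
-- the crossing arcs so that visiting the new vertex splits its lengthened arc into an arc of
-- the original length and an arc of length x, then there is a Hamiltonian path in K_(v + x)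
-- with x further arcs of length x, and the construction can be repeated.  If every arc
-- crosses at most one of several cuts, then the cuts can be grown independently.  So one path
-- with cuts for some of x = 1, 6, 18 settles all multisets obtained from its own by adding
-- multiples of x to the multiplicity of x.  A finite list of such paths, found by computer
-- search, covers every multiset of an order v ≥ 36 coprime to 6.
module Submission where

open import Defs
open import Algebra.Properties.CommutativeSemigroup using (xy∙z≈xz∙y)
open import Data.Bool using (Bool; true; false; if_then_else_)
open import Data.Empty using (⊥)
open import Data.List using (List; []; _∷_; _++_; map; length; replicate; upTo; applyUpTo)
open import Data.List.Membership.Propositional using (_∈_)
open import Data.List.Properties using (++-assoc; map-upTo; map-++; map-id; map-cong; map-cong-local; map-∘; length-++; length-map; length-replicate; length-upTo; ≡-dec)
open import Data.List.Relation.Binary.Permutation.Propositional using (_↭_; ↭-refl; ↭-reflexive; ↭-sym; ↭-trans; prep; swap; module PermutationReasoning)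
open import Data.List.Relation.Binary.Permutation.Propositional.Properties using (map⁺; ++⁺; ++⁺ˡ; ++-comm; shift; shifts; ↭-length; All-resp-↭)
open import Data.List.Relation.Unary.All as All using (All; []; _∷_)
import Data.List.Relation.Unary.All.Properties as All
open import Data.List.Relation.Unary.AllPairs using (AllPairs; []; _∷_)
open import Data.List.Relation.Unary.Any as Any using (Any; here; there)
import Data.List.Relation.Unary.Any.Properties as Any
open import Data.Maybe using (Maybe; just; nothing)
open import Data.Nat
open import Data.Nat.Divisibility using (_∣_; _∣?_; divides; ∣m∣n⇒∣m+n; ∣n⇒∣m*n; ∣-trans; ∣1⇒≡1)
open import Data.Nat.DivMod using (m≡m%n+[m/n]*n; m%n<n; m/n*n≤m)
open import Data.Nat.GCD using (gcd-greatest)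
open import Data.Nat.Properties
open import Data.Nat.Solver using (module +-*-Solver)
open import Data.List.Sort.InsertionSort.Base ≤-decTotalOrder using (sort)
open import Data.List.Sort.InsertionSort.Properties ≤-decTotalOrder using (sort-↭)
open import Data.Product using (_×_; _,_; proj₁; proj₂; ∃; ∃₂)
open import Data.Sum using (_⊎_; inj₁; inj₂)
open import Data.Unit using (⊤; tt)
open import Function using (_∘_; id)
open import Relation.Binary.PropositionalEquality using (_≡_; _≢_; refl; sym; trans; cong; cong₂; subst; module ≡-Reasoning)
open import Relation.Nullary using (Dec; does; yes; no; ¬_; contradiction)
open import Relation.Nullary.Decidable using (_×-dec_; _⊎-dec_)

-- Both conditions on `v` come from members of the multiset: 18 forces 18 ≤ v/2, so v ≥ 36, and 6
-- forces gcd(v, 6) = 1. Growth can be repeated because, of the two pieces of a split arc, only the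
-- first crosses the cut again, and it has the new vertex q as its slot. After t rounds each
-- original crossing arc carries the progression q, q + x, ..., q + (t - 1)x, while the cut and its
-- window stay where they are. Finiteness: a cut of gain x moves the multiplicity of x alone, in
-- steps of x. So one path stands for a residue class of each multiplicity for which it has a cut,
-- and for a single value of the others. Each multiplicity is therefore either one of finitely many
-- small values or in one of x tails, one per residue modulo x. A choice of such a set for each of
-- 1, 6 and 18 is a box, and one path has to serve a whole box. A box unbounded in 6 or 18 only has
-- constant order modulo 6, so it is discarded or kept as a whole; a box unbounded in 1 contains all
-- large orders and has to be served entirely.

swap-last : ∀ a b c → a + b + c ≡ a + c + b
swap-last = xy∙z≈xz∙y +-commutativeSemigroup

-- Marked walks on the cycle, and cuts filled by their slots.

data Span : Set where
  direct wrap : Span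

data Side : Set where
  tail head : Side

data Dir : Set where
  forth back : Dir

-- at x σ marks an arc that crosses the cut of gain x and has its slot on side σ.
data Mark : Set where
  none : Mark
  at   : ℕ → Side → Mark

-- Growing inserts gain new vertices between pos ∸ 1 and pos.
record Cut : Set where
  constructor cut
  field
    gain pos : ℕ
open Cut

-- z need not be the length of the edge {i, j}: the walks below may have v < 2z, and only grown ones
-- with v ≥ 2z are used as realizations.
IsArc : Span → ℕ → ℕ → ℕ → ℕ → Set
IsArc direct v z i j = i + z ≡ j
IsArc wrap   v z i j = i + z ≡ v + j

Avoids : Span → ℕ → ℕ → ℕ → Set
Avoids direct m i j = j < m ⊎ m ≤ i
Avoids wrap   m i j = j < m × m ≤ i

-- A wrapping arc with m ≤ j crosses m as well; rotating the labels so that one cut sits at v avoids that case.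
Meets : Span → ℕ → ℕ → ℕ → Set
Meets direct m i j = i < m × m ≤ j
Meets wrap   m i j = i < m × j < m

-- The new vertex on a crossing arc, in the labels of K_(v + x): at distance x from the tail, or at
-- distance x from the shifted head.
slot : Side → Span → ℕ → ℕ → ℕ → ℕ → ℕ
slot tail s      v x i j = i + x
slot head direct v x i j = j
slot head wrap   v x i j = v + j

InWindow : Cut → ℕ → Set
InWindow (cut x m) q = m ≤ q × q < m + x

window : Cut → List ℕ
window (cut x m) = map (m +_) (upTo x)

sideAt : ℕ → Mark → Maybe Side
sideAt x none     = nothing
sideAt x (at y σ) = if y ≡ᵇ x then just σ else nothing

CutArc : ℕ → Cut → Maybe Side → Span → ℕ → ℕ → Set
CutArc v c nothing  s i j = Avoids s (pos c) i j
CutArc v c (just σ) s i j = Meets s (pos c) i j × InWindow c (slot σ s v (gain c) i j)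

record Step : Set where
  constructor step
  field
    dir    : Dir
    len    : ℕ
    span   : Span
    mark   : Mark
    target : ℕ
open Step

on : {A : Set₁} → (ℕ → ℕ → A) → Dir → ℕ → ℕ → A
on P forth u w = P u w
on P back  u w = P w u

slotOf : ℕ → ℕ → Side → ℕ → Step → ℕ
slotOf v x σ u (step forth z s μ w) = slot σ s v x u w
slotOf v x σ u (step back  z s μ w) = slot σ s v x w u

ArcStep : ℕ → ℕ → Step → Set
ArcStep v u (step d z s μ w) = on (IsArc s v z) d u w

CutStep : ℕ → Cut → ℕ → Step → Set
CutStep v c u (step d z s μ w) = on (CutArc v c (sideAt (gain c) μ) s) d u w

Walk : (ℕ → Step → Set) → ℕ → List Step → Set
Walk P u []         = ⊤
Walk P u (st ∷ sts) = P u st × Walk P (target st) sts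

slotsIn : ℕ → ℕ → Maybe Side → ℕ → Step → List ℕ
slotsIn v x nothing  u st = []
slotsIn v x (just σ) u st = slotOf v x σ u st ∷ []

slots : ℕ → ℕ → ℕ → List Step → List ℕ
slots v x u []         = []
slots v x u (st ∷ sts) = slotsIn v x (sideAt x (mark st)) u st ++ slots v x (target st) sts

Filled : ℕ → ℕ → List Step → Cut → Set
Filled v u sts c = Walk (CutStep v c) u sts × slots v (gain c) u sts ↭ window c

vertices : ℕ → List Step → List ℕ
vertices u sts = u ∷ map target sts

record Growable (v : ℕ) (cs : List Cut) (ls : List ℕ) : Set where
  field
    origin   : ℕ
    steps   : List Step
    arcs    : Walk (ArcStep v) origin steps
    filled  : All (Filled v origin steps) cs
    -- The position `v` itself is allowed: it is the gap between the labels `v ∸ 1` and 0.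
    inside  : All ((_≤ v) ∘ pos) cs
    covers  : vertices origin steps ↭ upTo v
    lengths : map len steps ↭ ls

-- One round of growth at a cut: its effect on labels, arcs, slots and other cuts.

module Growth (v x m : ℕ) where

  c₀ : Cut
  c₀ = cut x m

  φ : ℕ → ℕ
  φ i with i <? m
  ... | yes _ = i
  ... | no  _ = i + x

  φ-< : ∀ {i} → i < m → φ i ≡ i
  φ-< {i} i<m with i <? m
  ... | yes _   = refl
  ... | no  i≮m = contradiction i<m i≮m

  φ-≥ : ∀ {i} → m ≤ i → φ i ≡ i + x
  φ-≥ {i} m≤i with i <? m
  ... | yes i<m = contradiction i<m (≤⇒≯ m≤i)
  ... | no  _   = refl

  -- A cut at `n` sits in front of the vertex `n`, so it moves only if `m < n`, whereas `φ` moves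
  -- vertices from `m` itself on. The cut at `m` stays in front of the inserted labels.
  δ : ℕ → ℕ
  δ n with n ≤? m
  ... | yes _ = 0
  ... | no  _ = x

  δ-≤ : ∀ {n} → n ≤ m → δ n ≡ 0
  δ-≤ {n} n≤m with n ≤? m
  ... | yes _   = refl
  ... | no  n≰m = contradiction n≤m n≰m

  δ-> : ∀ {n} → m < n → δ n ≡ x
  δ-> {n} m<n with n ≤? m
  ... | yes n≤m = contradiction m<n (≤⇒≯ n≤m)
  ... | no  _   = refl

  moveCut : Cut → Cut
  moveCut (cut y n) = cut y (n + δ n)

  -- On a direct arc that misses the cut both ends move by `x` or neither does; on a wrapping one
  -- the tail moves, and so does the order.
  arc-shift : ∀ s {z i j} → IsArc s v z i j → Avoids s m i j → IsArc s (v + x) z (φ i) (φ j)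
  arc-shift direct {z} {i} {j} p (inj₁ j<m)
    rewrite φ-< (≤-<-trans (≤-trans (m≤m+n i z) (≤-reflexive p)) j<m) | φ-< j<m = p
  arc-shift direct {z} {i} {j} p (inj₂ m≤i)
    rewrite φ-≥ m≤i | φ-≥ (≤-trans m≤i (≤-trans (m≤m+n i z) (≤-reflexive p))) =
    trans (swap-last i x z) (cong (_+ x) p)
  arc-shift wrap {z} {i} {j} p (j<m , m≤i) rewrite φ-< j<m | φ-≥ m≤i =
    trans (swap-last i x z) (trans (cong (_+ x) p) (swap-last v j x))

  avoid-shift-self : ∀ s {i j} → Avoids s m i j → Avoids s m (φ i) (φ j)
  avoid-shift-self direct (inj₁ j<m) rewrite φ-< j<m = inj₁ j<m
  avoid-shift-self direct {i} (inj₂ m≤i) rewrite φ-≥ m≤i = inj₂ (≤-trans m≤i (m≤m+n i x))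
  avoid-shift-self wrap {i} (j<m , m≤i) rewrite φ-< j<m | φ-≥ m≤i = j<m , ≤-trans m≤i (m≤m+n i x)

  -- With `φ-mono-≤`: no old vertex changes sides with respect to any cut, which is why crossing and
  -- avoiding persist.
  φ-mono-< : ∀ {i n} → i < n → φ i < n + δ n
  φ-mono-< {i} {n} i<n with n ≤? m
  ... | yes n≤m rewrite φ-< (<-≤-trans i<n n≤m) = <-≤-trans i<n (m≤m+n n 0)
  ... | no  _ with i <? m
  ...   | yes _ = <-≤-trans i<n (m≤m+n n x)
  ...   | no  _ = +-monoˡ-< x i<n

  φ-mono-≤ : ∀ {i n} → n ≤ i → n + δ n ≤ φ i
  φ-mono-≤ {i} {n} n≤i with n ≤? m
  ... | yes n≤m rewrite +-identityʳ n with i <? m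
  ...   | yes _ = n≤i
  ...   | no  _ = ≤-trans n≤i (m≤m+n i x)
  φ-mono-≤ {i} {n} n≤i | no n≰m rewrite φ-≥ (≤-trans (<⇒≤ (≰⇒> n≰m)) n≤i) = +-monoˡ-≤ x n≤i

  avoid-shift : ∀ s {n i j} → Avoids s n i j → Avoids s (n + δ n) (φ i) (φ j)
  avoid-shift direct (inj₁ j<n)  = inj₁ (φ-mono-< j<n)
  avoid-shift direct (inj₂ n≤i)  = inj₂ (φ-mono-≤ n≤i)
  avoid-shift wrap   (j<n , n≤i) = φ-mono-< j<n , φ-mono-≤ n≤i

  meet-shift : ∀ s {n i j} → Meets s n i j → Meets s (n + δ n) (φ i) (φ j)
  meet-shift direct (i<n , n≤j) = φ-mono-< i<n , φ-mono-≤ n≤j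
  meet-shift wrap   (i<n , j<n) = φ-mono-< i<n , φ-mono-< j<n

  -- The disjunction says that `m` does not separate `i` from the cut `n`, so vertex and cut are
  -- displaced together.
  φ-δ-< : ∀ {i n} → i < n → (n ≤ m ⊎ m ≤ i) → φ i ≡ i + δ n
  φ-δ-< {i} i<n (inj₁ n≤m) = trans (φ-< (<-≤-trans i<n n≤m)) (trans (sym (+-identityʳ i)) (cong (i +_) (sym (δ-≤ n≤m))))
  φ-δ-< {i} i<n (inj₂ m≤i) = trans (φ-≥ m≤i) (cong (i +_) (sym (δ-> (≤-<-trans m≤i i<n))))

  -- An arc that crosses `n` and avoids `m` determines on which side of `m` the cut `n` lies, and
  -- the end or the order from which its slot is computed moves along with that cut. Hence the slots
  -- of `n` follow their window.
  slot-shift : ∀ σ s {n y i j} → Avoids s m i j → Meets s n i j →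
               slot σ s (v + x) y (φ i) (φ j) ≡ slot σ s v y i j + δ n
  slot-shift tail direct {n} {y} {i} (inj₁ j<m) (i<n , n≤j)
    rewrite φ-δ-< i<n (inj₁ (≤-trans n≤j (<⇒≤ j<m))) = swap-last i (δ n) y
  slot-shift tail direct {n} {y} {i} (inj₂ m≤i) (i<n , n≤j)
    rewrite φ-δ-< i<n (inj₂ m≤i) = swap-last i (δ n) y
  slot-shift head direct {n} {y} {i} {j} (inj₁ j<m) (i<n , n≤j)
    rewrite φ-< j<m | δ-≤ (≤-trans n≤j (<⇒≤ j<m)) = sym (+-identityʳ j)
  slot-shift head direct {n} {y} {i} {j} (inj₂ m≤i) (i<n , n≤j)
    rewrite φ-≥ (≤-trans m≤i (≤-trans (<⇒≤ i<n) n≤j)) | δ-> (≤-<-trans m≤i i<n) = refl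
  slot-shift tail wrap {n} {y} {i} {j} (j<m , m≤i) (i<n , j<n)
    rewrite φ-≥ m≤i | δ-> (≤-<-trans m≤i i<n) = swap-last i x y
  slot-shift head wrap {n} {y} {i} {j} (j<m , m≤i) (i<n , j<n)
    rewrite φ-< j<m | δ-> (≤-<-trans m≤i i<n) = swap-last v x j

  window-shift : ∀ {y n q} → InWindow (cut y n) q → InWindow (cut y (n + δ n)) (q + δ n)
  window-shift {y} {n} {q} (n≤q , q<n+y) =
    +-monoˡ-≤ (δ n) n≤q , subst (q + δ n <_) (swap-last n y (δ n)) (+-monoˡ-< (δ n) q<n+y)

  -- The slot is at distance `x` from one end of the lengthened arc: the piece at that end has
  -- length `x`, the other inherits `z`.
  before after : Side → ℕ → ℕ
  before tail z = x
  before head z = z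
  after  tail z = z
  after  head z = x

  -- Even on a wrapping arc the cut is met before label 0, so the first piece is direct and the wrap
  -- is left to the second piece.
  arc-before : ∀ σ s {z i j} → IsArc s v z i j → Meets s m i j →
               IsArc direct (v + x) (before σ z) (φ i) (slot σ s v x i j)
  arc-before tail direct p (i<m , _) rewrite φ-< i<m = refl
  arc-before tail wrap   p (i<m , _) rewrite φ-< i<m = refl
  arc-before head direct p (i<m , _) rewrite φ-< i<m = p
  arc-before head wrap   p (i<m , _) rewrite φ-< i<m = p

  arc-after : ∀ σ s {z i j} → IsArc s v z i j → Meets s m i j →
              IsArc s (v + x) (after σ z) (slot σ s v x i j) (φ j)
  arc-after tail direct {z} {i} p (_ , m≤j) rewrite φ-≥ m≤j = trans (swap-last i x z) (cong (_+ x) p)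
  arc-after head direct p (_ , m≤j) rewrite φ-≥ m≤j = refl
  arc-after tail wrap {z} {i} {j} p (_ , j<m) rewrite φ-< j<m =
    trans (swap-last i x z) (trans (cong (_+ x) p) (swap-last v j x))
  arc-after head wrap {z} {i} {j} p (_ , j<m) rewrite φ-< j<m = swap-last v j x

  meet-before : ∀ s {i j q} → Meets s m i j → InWindow c₀ q → Meets direct m (φ i) q
  meet-before direct (i<m , _) (m≤q , _) rewrite φ-< i<m = i<m , m≤q
  meet-before wrap   (i<m , _) (m≤q , _) rewrite φ-< i<m = i<m , m≤q

  avoid-after-self : ∀ s {i j q} → Meets s m i j → InWindow c₀ q → Avoids s m q (φ j)
  avoid-after-self direct _         (m≤q , _) = inj₂ m≤q
  avoid-after-self wrap   (_ , j<m) (m≤q , _) rewrite φ-< j<m = j<m , m≤q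

  -- With `window-≥`: the inserted vertices all lie on one side of every other cut.
  window-< : ∀ {n q} → InWindow c₀ q → m < n → q < n + δ n
  window-< {n} (_ , q<m+x) m<n rewrite δ-> m<n = <-trans q<m+x (+-monoˡ-< x m<n)

  window-≥ : ∀ {n q} → InWindow c₀ q → n ≤ m → n + δ n ≤ q
  window-≥ {n} (m≤q , _) n≤m rewrite δ-≤ n≤m | +-identityʳ n = ≤-trans n≤m m≤q

  -- The inserted vertex lies on the arc, so each piece misses every cut that the whole arc misses.
  avoid-before : ∀ s {n i j q} → Meets s m i j → Avoids s n i j → InWindow c₀ q →
                 Avoids direct (n + δ n) (φ i) q
  avoid-before direct (i<m , m≤j) (inj₁ j<n)  w = inj₁ (window-< w (≤-<-trans m≤j j<n))
  avoid-before direct _           (inj₂ n≤i)  w = inj₂ (φ-mono-≤ n≤i)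
  avoid-before wrap   _           (_ , n≤i)   w = inj₂ (φ-mono-≤ n≤i)

  avoid-after : ∀ s {n i j q} → Meets s m i j → Avoids s n i j → InWindow c₀ q →
                Avoids s (n + δ n) q (φ j)
  avoid-after direct _           (inj₁ j<n)  w = inj₁ (φ-mono-< j<n)
  avoid-after direct (i<m , _)   (inj₂ n≤i)  w = inj₂ (window-≥ w (≤-trans n≤i (<⇒≤ i<m)))
  avoid-after wrap   (i<m , _)   (j<n , n≤i) w = φ-mono-< j<n , window-≥ w (≤-trans n≤i (<⇒≤ i<m))

  -- A crossing arc from i to j becomes an arc from i to its slot q, which crosses the cut again and
  -- has q as its head slot, followed by an arc from q to the shifted j, which no longer crosses it.
  growStep : Maybe Side → ℕ → Step → List Step
  growStep nothing  u (step d z s μ w)     = step d z s μ (φ w) ∷ []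
  growStep (just σ) u (step forth z s μ w) =
    step forth (before σ z) direct (at x head) (slot σ s v x u w) ∷ step forth (after σ z) s none (φ w) ∷ []
  growStep (just σ) u (step back z s μ w)  =
    step back (after σ z) s none (slot σ s v x w u) ∷ step back (before σ z) direct (at x head) (φ w) ∷ []

  -- The recursion passes on old labels, since slots are read off the ungrown walk; the targets
  -- produced carry new labels.
  grow : ℕ → List Step → List Step
  grow u []         = []
  grow u (st ∷ sts) = growStep (sideAt x (mark st)) u st ++ grow (target st) sts

  sideAt-refl : ∀ y σ → sideAt y (at y σ) ≡ just σ
  sideAt-refl y σ with y ≡ᵇ y | ≡⇒≡ᵇ y y refl
  ... | true | _ = refl

  sideAt-≢ : ∀ {y} z σ → z ≢ y → sideAt y (at z σ) ≡ nothing
  sideAt-≢ {y} z σ z≢y with z ≡ᵇ y | ≡ᵇ⇒≡ z y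
  ... | true  | f = contradiction (f _) z≢y
  ... | false | _ = refl

  -- A mark names one gain and distinct cuts have distinct gains: this is how an arc is kept from
  -- crossing two cuts.
  sideAt-unique : ∀ {y} μ {σ} → x ≢ y → sideAt x μ ≡ just σ → sideAt y μ ≡ nothing
  sideAt-unique {y} (at z τ) x≢y eq with z ≡ᵇ x | ≡ᵇ⇒≡ z x
  ... | true | f = sideAt-≢ z τ (λ z≡y → x≢y (trans (sym (f _)) z≡y))

  -- Whether a step is kept or split, its replacement ends at `φ` of the old target, so properties
  -- of the grown walk can be verified one replacement at a time.
  walk-grow : {P Q : ℕ → Step → Set} →
              (∀ u st → Q u st → Walk P (φ u) (growStep (sideAt x (mark st)) u st)) →
              ∀ u sts → Walk Q u sts → Walk P (φ u) (grow u sts)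
  walk-grow f u [] _ = tt
  walk-grow f u (st ∷ sts) (q , qs) with sideAt x (mark st) | f u st q
  walk-grow f u (step d z s μ w ∷ sts) (q , qs) | nothing | p , _ = p , walk-grow f w sts qs
  walk-grow f u (step forth z s μ w ∷ sts) (q , qs) | just σ | p , p′ , _ = p , p′ , walk-grow f w sts qs
  walk-grow f u (step back z s μ w ∷ sts) (q , qs) | just σ | p , p′ , _ = p , p′ , walk-grow f w sts qs

  arcs-grow : ∀ u st → ArcStep v u st × CutStep v c₀ u st →
              Walk (ArcStep (v + x)) (φ u) (growStep (sideAt x (mark st)) u st)
  arcs-grow u (step d z s μ w) q with sideAt x μ
  arcs-grow u (step forth z s μ w) (p , a) | nothing = arc-shift s p a , tt
  arcs-grow u (step back z s μ w) (p , a) | nothing = arc-shift s p a , tt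
  arcs-grow u (step forth z s μ w) (p , a , _) | just σ = arc-before σ s p a , arc-after σ s p a , tt
  arcs-grow u (step back z s μ w) (p , a , _) | just σ = arc-after σ s p a , arc-before σ s p a , tt

  cut-grow-self : ∀ u st → CutStep v c₀ u st →
                  Walk (CutStep (v + x) c₀) (φ u) (growStep (sideAt x (mark st)) u st)
  cut-grow-self u (step d z s μ w) q with sideAt x μ in eq
  cut-grow-self u (step forth z s μ w) a | nothing rewrite eq = avoid-shift-self s a , tt
  cut-grow-self u (step back z s μ w) a | nothing rewrite eq = avoid-shift-self s a , tt
  cut-grow-self u (step forth z s μ w) (a , k) | just σ rewrite sideAt-refl x head =
    (meet-before s a k , k) , avoid-after-self s a k , tt
  cut-grow-self u (step back z s μ w) (a , k) | just σ rewrite sideAt-refl x head =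
    avoid-after-self s a k , (meet-before s a k , k) , tt

  cutArc-shift : ∀ c o s {i j} → Avoids s m i j → CutArc v c o s i j → CutArc (v + x) (moveCut c) o s (φ i) (φ j)
  cutArc-shift c nothing  s a b = avoid-shift s b
  cutArc-shift c (just σ) s a (b , k) =
    meet-shift s b , subst (InWindow (moveCut c)) (sym (slot-shift σ s a b)) (window-shift k)

  -- A split arc crosses the cut being grown, hence avoids `c`, and so do both pieces; a kept arc
  -- behaves towards `c` as before, up to the common displacement.
  cut-grow-other : ∀ c → x ≢ gain c → ∀ u st → CutStep v c₀ u st × CutStep v c u st →
                   Walk (CutStep (v + x) (moveCut c)) (φ u) (growStep (sideAt x (mark st)) u st)
  cut-grow-other c x≢y u (step d z s μ w) q with sideAt x μ in eq
  cut-grow-other c x≢y u (step forth z s μ w) (a , b) | nothing = cutArc-shift c (sideAt (gain c) μ) s a b , tt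
  cut-grow-other c x≢y u (step back z s μ w) (a , b) | nothing = cutArc-shift c (sideAt (gain c) μ) s a b , tt
  cut-grow-other c x≢y u (step forth z s μ w) ((a , k) , b) | just σ
    rewrite sideAt-unique μ x≢y eq | sideAt-≢ x head x≢y = avoid-before s a b k , avoid-after s a b k , tt
  cut-grow-other c x≢y u (step back z s μ w) ((a , k) , b) | just σ
    rewrite sideAt-unique μ x≢y eq | sideAt-≢ x head x≢y = avoid-after s a b k , avoid-before s a b k , tt

  -- The head slot of a direct arc is its head, so the first piece of a split arc reproduces the old
  -- slot, and the second piece has none. This makes the cut ready for another round.
  slots-grow-self : ∀ u sts → slots (v + x) x (φ u) (grow u sts) ≡ slots v x u sts
  slots-grow-self u [] = refl
  slots-grow-self u (st ∷ sts) with sideAt x (mark st) in eq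
  slots-grow-self u (step d z s μ w ∷ sts) | nothing rewrite eq = slots-grow-self w sts
  slots-grow-self u (step forth z s μ w ∷ sts) | just σ rewrite sideAt-refl x head =
    cong (_ ∷_) (slots-grow-self w sts)
  slots-grow-self u (step back z s μ w ∷ sts) | just σ rewrite sideAt-refl x head =
    cong (_ ∷_) (slots-grow-self w sts)

  slots-grow-other : ∀ c → x ≢ gain c → ∀ u sts → Walk (CutStep v c₀) u sts → Walk (CutStep v c) u sts →
                     slots (v + x) (gain c) (φ u) (grow u sts) ≡ map (_+ δ (pos c)) (slots v (gain c) u sts)
  slots-grow-other c x≢y u [] _ _ = refl
  slots-grow-other c x≢y u (st ∷ sts) (a , as) (b , bs) with sideAt x (mark st) in eq
  slots-grow-other c x≢y u (step d z s μ w ∷ sts) (a , as) (b , bs) | nothing with sideAt (gain c) μ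
  ... | nothing = slots-grow-other c x≢y w sts as bs
  slots-grow-other c x≢y u (step forth z s μ w ∷ sts) (a , as) (b , bs) | nothing | just σ =
    cong₂ _∷_ (slot-shift σ s a (proj₁ b)) (slots-grow-other c x≢y w sts as bs)
  slots-grow-other c x≢y u (step back z s μ w ∷ sts) (a , as) (b , bs) | nothing | just σ =
    cong₂ _∷_ (slot-shift σ s a (proj₁ b)) (slots-grow-other c x≢y w sts as bs)
  slots-grow-other c x≢y u (step forth z s μ w ∷ sts) (a , as) (b , bs) | just σ
    rewrite sideAt-unique μ x≢y eq | sideAt-≢ x head x≢y = slots-grow-other c x≢y w sts as bs
  slots-grow-other c x≢y u (step back z s μ w ∷ sts) (a , as) (b , bs) | just σ
    rewrite sideAt-unique μ x≢y eq | sideAt-≢ x head x≢y = slots-grow-other c x≢y w sts as bs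

  targets-grow : ∀ u sts → map target (grow u sts) ↭ map φ (map target sts) ++ slots v x u sts
  targets-grow u [] = ↭-refl
  targets-grow u (st ∷ sts) with sideAt x (mark st)
  targets-grow u (step d z s μ w ∷ sts) | nothing = prep _ (targets-grow w sts)
  targets-grow u (step forth z s μ w ∷ sts) | just σ =
    ↭-trans (swap _ _ (targets-grow w sts)) (prep _ (↭-sym (shift _ (map φ (map target sts)) _)))
  targets-grow u (step back z s μ w ∷ sts) | just σ =
    ↭-trans (swap _ _ (targets-grow w sts)) (prep _ (↭-sym (shift _ (map φ (map target sts)) _)))

  -- Which piece has length `x`, and which is walked first, depends on side and direction; as a
  -- multiset the outcome is always the old length and one more `x`.
  lens-grow : ∀ u sts → map len (grow u sts) ↭ replicate (length (slots v x u sts)) x ++ map len sts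
  lens-grow u [] = ↭-refl
  lens-grow u (st ∷ sts) with sideAt x (mark st)
  lens-grow u (step d z s μ w ∷ sts) | nothing =
    ↭-trans (prep z (lens-grow w sts)) (↭-sym (shift z (replicate (length (slots v x w sts)) x) (map len sts)))
  lens-grow u (step forth z s μ w ∷ sts) | just σ =
    ↭-trans (before-after σ (lens-grow w sts)) (prep x (↭-sym (shift z (replicate (length (slots v x w sts)) x) (map len sts))))
    where
    before-after : ∀ σ {as bs} → as ↭ bs → before σ z ∷ after σ z ∷ as ↭ x ∷ z ∷ bs
    before-after tail p = prep x (prep z p)
    before-after head p = swap z x p
  lens-grow u (step back z s μ w ∷ sts) | just σ =
    ↭-trans (after-before σ (lens-grow w sts)) (prep x (↭-sym (shift z (replicate (length (slots v x w sts)) x) (map len sts))))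
    where
    after-before : ∀ σ {as bs} → as ↭ bs → after σ z ∷ before σ z ∷ as ↭ x ∷ z ∷ bs
    after-before tail p = swap z x p
    after-before head p = prep x (prep z p)

-- The growth theorem.

applyUpTo-+ : {A : Set} (f : ℕ → A) → ∀ a b → applyUpTo f (a + b) ≡ applyUpTo f a ++ applyUpTo (f ∘ (a +_)) b
applyUpTo-+ f zero    b = refl
applyUpTo-+ f (suc a) b = cong (f 0 ∷_) (applyUpTo-+ (f ∘ suc) a b)

upTo-+ : ∀ a b → upTo (a + b) ≡ upTo a ++ map (a +_) (upTo b)
upTo-+ a b = trans (applyUpTo-+ id a b) (cong (upTo a ++_) (sym (map-upTo (a +_) b)))

module _ {v x m : ℕ} where
  open Growth v x m

  -- `φ` fixes the labels below `m` and pushes the rest up by `x`; the gap it leaves is the window.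
  -- The form `m + k` builds `m ≤ v` into the order.
  upTo-grow : ∀ k → map φ (upTo (m + k)) ++ window c₀ ↭ upTo (m + k + x)
  upTo-grow k = begin
    map φ (upTo (m + k)) ++ window c₀
      ≡⟨ cong (λ l → map φ l ++ window c₀) (upTo-+ m k) ⟩
    map φ (upTo m ++ map (m +_) (upTo k)) ++ window c₀
      ≡⟨ cong (_++ window c₀) (map-++ φ (upTo m) _) ⟩
    (map φ (upTo m) ++ map φ (map (m +_) (upTo k))) ++ window c₀
      ≡⟨ cong₂ (λ l r → (l ++ r) ++ window c₀) low high ⟩
    (upTo m ++ map ((m + x) +_) (upTo k)) ++ window c₀
      ≡⟨ ++-assoc (upTo m) _ _ ⟩
    upTo m ++ (map ((m + x) +_) (upTo k) ++ window c₀)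
      ↭⟨ ++⁺ˡ (upTo m) (++-comm (map ((m + x) +_) (upTo k)) (window c₀)) ⟩
    upTo m ++ (window c₀ ++ map ((m + x) +_) (upTo k))
      ≡⟨ ++-assoc (upTo m) _ _ ⟨
    (upTo m ++ window c₀) ++ map ((m + x) +_) (upTo k)
      ≡⟨ cong (_++ map ((m + x) +_) (upTo k)) (upTo-+ m x) ⟨
    upTo (m + x) ++ map ((m + x) +_) (upTo k)
      ≡⟨ upTo-+ (m + x) k ⟨
    upTo (m + x + k)
      ≡⟨ cong upTo (swap-last m x k) ⟩
    upTo (m + k + x) ∎
    where
    open PermutationReasoning
    low : map φ (upTo m) ≡ upTo m
    low = trans (map-cong-local (All.map φ-< (All.all-upTo m))) (map-id (upTo m))
    high : map φ (map (m +_) (upTo k)) ≡ map ((m + x) +_) (upTo k)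
    high = trans (sym (map-∘ (upTo k)))
                 (map-cong (λ i → trans (φ-≥ (m≤m+n m i)) (swap-last m i x)) (upTo k))

walk-× : {P Q : ℕ → Step → Set} → ∀ u sts → Walk P u sts → Walk Q u sts → Walk (λ u st → P u st × Q u st) u sts
walk-× u [] _ _ = tt
walk-× u (st ∷ sts) (p , ps) (q , qs) = (p , q) , walk-× (target st) sts ps qs

moveCuts : ℕ → Cut → List Cut → List Cut
moveCuts v (cut x m) = map (Growth.moveCut v x m)

growable-grow : ∀ {v c cs ls} → All (λ c′ → gain c ≢ gain c′) cs → Growable v (c ∷ cs) ls →
                Growable (v + gain c) (c ∷ moveCuts v c cs) (replicate (gain c) (gain c) ++ ls)
growable-grow {v} {cut x m} {cs} {ls} distinct g = record
  { origin   = φ origin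
  ; steps   = grow origin steps
  ; arcs    = walk-grow arcs-grow origin steps (walk-× origin steps arcs meets)
  ; filled  = (walk-grow cut-grow-self origin steps meets ,
               ↭-trans (↭-reflexive (slots-grow-self origin steps)) full) ∷
              All.map⁺ (All.zipWith others (distinct , All.tail filled))
  ; inside  = ≤-trans (All.head inside) (m≤m+n v x) ∷ All.map⁺ (All.map (λ {c} → moved {c}) (All.tail inside))
  ; covers  = begin
      φ origin ∷ map target (grow origin steps)               ↭⟨ prep (φ origin) (targets-grow origin steps) ⟩
      map φ (vertices origin steps) ++ slots v x origin steps ↭⟨ ++⁺ (map⁺ φ covers) full ⟩
      map φ (upTo v) ++ window c₀                           ↭⟨ extend ⟩
      upTo (v + x)                                          ∎
  ; lengths = ↭-trans (lens-grow origin steps)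
      -- The slots are a permutation of the window, so exactly `x` arcs are split and exactly `x`
      -- copies of `x` are gained.
      (++⁺ (↭-reflexive (cong (λ n → replicate n x) (trans (↭-length full) (trans (length-map _ (upTo x)) (length-upTo x))))) lengths)
  }
  where
  open Growable g
  open Growth v x m
  open PermutationReasoning
  meets : Walk (CutStep v c₀) origin steps
  meets = proj₁ (All.head filled)
  full : slots v x origin steps ↭ window c₀
  full = proj₂ (All.head filled)
  extend : map φ (upTo v) ++ window c₀ ↭ upTo (v + x)
  extend = subst (λ n → map φ (upTo n) ++ window c₀ ↭ upTo (n + x)) (m+[n∸m]≡n (All.head inside))
                 (upTo-grow {v} {x} {m} (v ∸ m))
  moved : ∀ {c} → pos c ≤ v → pos (moveCut c) ≤ v + x
  moved {cut y n} n≤v with n ≤? m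
  ... | yes _ = +-mono-≤ n≤v (z≤n {x})
  ... | no  _ = +-monoˡ-≤ x n≤v
  others : ∀ {c} → x ≢ gain c × Filled v origin steps c →
           Filled (v + x) (φ origin) (grow origin steps) (moveCut c)
  others {c} (x≢y , p , q) =
    walk-grow (cut-grow-other c x≢y) origin steps (walk-× origin steps meets p) ,
    ↭-trans (↭-reflexive (slots-grow-other c x≢y origin steps meets p))
      (↭-trans (map⁺ (_+ δ (pos c)) q) (↭-reflexive
        (trans (sym (map-∘ (upTo (gain c)))) (map-cong (λ i → swap-last (pos c) i (δ (pos c))) (upTo (gain c))))))

-- From walks to realizations.

edgeLength-comm : ∀ v i j → edgeLength v i j ≡ edgeLength v j i
edgeLength-comm v i j = cong (λ d → d ⊓ (v ∸ d)) (∣-∣-comm i j)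

-- The labels differ by `z` or, on a wrapping arc, by `v ∸ z`; the bound `z + z ≤ v` makes `z` the
-- smaller of the two distances.
edgeLength-arc : ∀ s {v z i j} → z + z ≤ v → IsArc s v z i j → edgeLength v i j ≡ z
edgeLength-arc direct {v} {z} {i} 2z≤v refl rewrite ∣m-m+n∣≡n i z = m≤n⇒m⊓n≡m (m+n≤o⇒m≤o∸n z 2z≤v)
edgeLength-arc wrap {v} {z} {i} {j} 2z≤v p = begin
  edgeLength v i j            ≡⟨ cong (λ k → edgeLength v k j) i≡ ⟩
  edgeLength v (j + (v ∸ z)) j ≡⟨ edgeLength-comm v (j + (v ∸ z)) j ⟩
  edgeLength v j (j + (v ∸ z)) ≡⟨ cong (λ d → d ⊓ (v ∸ d)) (∣m-m+n∣≡n j (v ∸ z)) ⟩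
  (v ∸ z) ⊓ (v ∸ (v ∸ z))     ≡⟨ cong ((v ∸ z) ⊓_) (m∸[m∸n]≡n z≤v) ⟩
  (v ∸ z) ⊓ z                 ≡⟨ m≥n⇒m⊓n≡n (m+n≤o⇒m≤o∸n z 2z≤v) ⟩
  z                           ∎
  where
  open ≡-Reasoning
  z≤v : z ≤ v
  z≤v = ≤-trans (m≤m+n z z) 2z≤v
  i≡ : i ≡ j + (v ∸ z)
  i≡ = +-cancelʳ-≡ z i (j + (v ∸ z))
    (trans p (trans (+-comm v j) (trans (cong (j +_) (sym (m∸n+n≡m z≤v))) (sym (+-assoc j (v ∸ z) z)))))

edgeLength-step : ∀ {v} u st → len st + len st ≤ v → ArcStep v u st → edgeLength v u (target st) ≡ len st
edgeLength-step u (step forth z s μ w) 2z≤v p = edgeLength-arc s 2z≤v p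
edgeLength-step {v} u (step back z s μ w) 2z≤v p = trans (edgeLength-comm v u w) (edgeLength-arc s 2z≤v p)

pathLengths-walk : ∀ {v} u sts → All (λ z → z + z ≤ v) (map len sts) → Walk (ArcStep v) u sts →
                   pathLengths v (vertices u sts) ≡ map len sts
pathLengths-walk u [] _ _ = refl
pathLengths-walk u (st ∷ sts) (2z≤v ∷ small) (p , ps) =
  cong₂ _∷_ (edgeLength-step u st 2z≤v p) (pathLengths-walk (target st) sts small ps)

-- This recovers the order from the multiset of lengths, so that repeated growth can leave the order
-- existential.
growable-size : ∀ {v cs ls} → Growable v cs ls → suc (length ls) ≡ v
growable-size {v} {ls = ls} g = begin
  suc (length ls)              ≡⟨ cong suc (↭-length lengths) ⟨
  suc (length (map len steps)) ≡⟨ cong suc (length-map len steps) ⟩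
  suc (length steps)           ≡⟨ cong suc (length-map target steps) ⟨
  length (vertices origin steps) ≡⟨ ↭-length covers ⟩
  length (upTo v)              ≡⟨ length-upTo v ⟩
  v                            ∎
  where
  open Growable g
  open ≡-Reasoning

growable⇒realizable : ∀ {v cs L} → Growable v cs L → All (λ z → z + z ≤ v) L → Realizable v L
growable⇒realizable g small =
  vertices origin steps , covers ,
  ↭-trans (↭-reflexive (pathLengths-walk origin steps (All-resp-↭ (↭-sym lengths) small) arcs)) lengths
  where open Growable g

-- Repeated growth at several cuts.

growable-↭ : ∀ {v cs ls ls′} → ls ↭ ls′ → Growable v cs ls → Growable v cs ls′
growable-↭ p g = record { Growable g; lengths = ↭-trans (Growable.lengths g) p }

growable-drop : ∀ {v c cs ls} → Growable v (c ∷ cs) ls → Growable v cs ls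
growable-drop g = record { Growable g; filled = All.tail (Growable.filled g); inside = All.tail (Growable.inside g) }

replicate-+ : ∀ {A : Set} a b (y : A) → replicate (a + b) y ≡ replicate a y ++ replicate b y
replicate-+ zero    b y = refl
replicate-+ (suc a) b y = cong (y ∷_) (replicate-+ a b y)

gains-moveCuts : ∀ v c cs → map gain (moveCuts v c cs) ≡ map gain cs
gains-moveCuts v c []        = refl
gains-moveCuts v c (c′ ∷ cs) = cong (gain c′ ∷_) (gains-moveCuts v c cs)

-- The remaining cuts are displaced in each round but keep their gains, which is all that later
-- growth needs to know about them. After the last round the cut has served its purpose and is
-- dropped.
growable-repeat : ∀ t {v x m cs ls} → All (x ≢_) (map gain cs) → Growable v (cut x m ∷ cs) ls →
                  ∃₂ λ v′ cs′ → map gain cs′ ≡ map gain cs × Growable v′ cs′ (replicate (t * x) x ++ ls)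
growable-repeat zero    distinct g = _ , _ , refl , growable-drop g
growable-repeat (suc t) {v} {x} {m} {cs} {ls} distinct g
  with growable-repeat t (subst (All (x ≢_)) (sym (gains-moveCuts v (cut x m) cs)) distinct)
                         (growable-grow (All.map⁻ distinct) g)
... | v′ , cs′ , eq , g′ = v′ , cs′ , trans eq (gains-moveCuts v (cut x m) cs) , growable-↭ regroup g′
  where
  open PermutationReasoning
  regroup : replicate (t * x) x ++ replicate x x ++ ls ↭ replicate (x + t * x) x ++ ls
  regroup = begin
    replicate (t * x) x ++ replicate x x ++ ls   ↭⟨ shifts (replicate (t * x) x) (replicate x x) ⟩
    replicate x x ++ replicate (t * x) x ++ ls   ≡⟨ ++-assoc (replicate x x) _ ls ⟨
    (replicate x x ++ replicate (t * x) x) ++ ls ≡⟨ cong (_++ ls) (replicate-+ x (t * x) x) ⟨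
    replicate (x + t * x) x ++ ls                ∎

extra : (ℕ → ℕ) → List ℕ → List ℕ → List ℕ
extra t []       ls = ls
extra t (x ∷ xs) ls = extra t xs (replicate (t x * x) x ++ ls)

-- Growing one cut keeps the remaining ones filled, so the cuts can be exhausted one after another.
growable-extra : ∀ (t : ℕ → ℕ) xs {v cs ls} → map gain cs ≡ xs → AllPairs _≢_ xs → Growable v cs ls →
                 ∃ λ v′ → Growable v′ [] (extra t xs ls)
growable-extra t []       {cs = []}         refl _ g = _ , g
growable-extra t (x ∷ xs) {cs = cut x m ∷ cs} refl (distinct ∷ rest) g
  with growable-repeat (t x) distinct g
... | _ , _ , eq , g′ = growable-extra t xs eq rest g′

-- Multisets over 1, 6 and 18 in normal form.

multi : ℕ → ℕ → ℕ → List ℕ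
multi a b c = replicate a 1 ++ replicate b 6 ++ replicate c 18

multi-1 : ∀ n a b c → replicate n 1 ++ multi a b c ↭ multi (n + a) b c
multi-1 n a b c = ↭-reflexive (trans (sym (++-assoc (replicate n 1) _ _))
  (cong (_++ replicate b 6 ++ replicate c 18) (sym (replicate-+ n a 1))))

multi-6 : ∀ n a b c → replicate n 6 ++ multi a b c ↭ multi a (n + b) c
multi-6 n a b c = ↭-trans (shifts (replicate n 6) (replicate a 1)) (++⁺ˡ (replicate a 1)
  (↭-reflexive (trans (sym (++-assoc (replicate n 6) _ _)) (cong (_++ replicate c 18) (sym (replicate-+ n b 6))))))

multi-18 : ∀ n a b c → replicate n 18 ++ multi a b c ↭ multi a b (n + c)
multi-18 n a b c = ↭-trans (shifts (replicate n 18) (replicate a 1)) (++⁺ˡ (replicate a 1)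
  (↭-trans (shifts (replicate n 18) (replicate b 6)) (++⁺ˡ (replicate b 6) (↭-reflexive (sym (replicate-+ n c 18))))))

Allowed : ℕ → Set
Allowed z = z ≡ 1 ⊎ z ≡ 6 ⊎ z ≡ 18

count : ℕ → List ℕ → ℕ
count z []       = 0
count z (y ∷ ys) = if y ≡ᵇ z then suc (count z ys) else count z ys

↭-multi : ∀ {ls} → All Allowed ls → ls ↭ multi (count 1 ls) (count 6 ls) (count 18 ls)
↭-multi [] = ↭-refl
↭-multi (inj₁ refl ∷ as)        = prep 1 (↭-multi as)
↭-multi {_ ∷ ls} (inj₂ (inj₁ refl) ∷ as) =
  ↭-trans (prep 6 (↭-multi as)) (multi-6 1 (count 1 ls) (count 6 ls) (count 18 ls))
↭-multi {_ ∷ ls} (inj₂ (inj₂ refl) ∷ as) =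
  ↭-trans (prep 18 (↭-multi as)) (multi-18 1 (count 1 ls) (count 6 ls) (count 18 ls))

present : Bool → ℕ → List ℕ
present true  x = x ∷ []
present false x = []

-- The Boolean tells whether there is a cut of gain `x`; without one the multiplicity of `x` cannot
-- be raised.
reach : Bool → ℕ → ℕ → ℕ
reach true  x t = t * x
reach false x t = 0

gains : Bool → Bool → Bool → List ℕ
gains g₁ g₆ g₁₈ = present g₁ 1 ++ present g₆ 6 ++ present g₁₈ 18

extra-multi : ∀ t g₁ g₆ g₁₈ a b c → extra t (gains g₁ g₆ g₁₈) (multi a b c) ↭
              multi (reach g₁ 1 (t 1) + a) (reach g₆ 6 (t 6) + b) (reach g₁₈ 18 (t 18) + c)
extra-multi t g₁ g₆ g₁₈ a b c = go₁ g₁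
  where
  extra-resp : ∀ xs {ls ls′} → ls ↭ ls′ → extra t xs ls ↭ extra t xs ls′
  extra-resp []       p = p
  extra-resp (x ∷ xs) p = extra-resp xs (++⁺ˡ (replicate (t x * x) x) p)
  go₁₈ : ∀ g a b c → extra t (present g 18) (multi a b c) ↭ multi a b (reach g 18 (t 18) + c)
  go₁₈ true  a b c = multi-18 (t 18 * 18) a b c
  go₁₈ false a b c = ↭-refl
  go₆ : ∀ g a b c → extra t (present g 6 ++ present g₁₈ 18) (multi a b c) ↭
        multi a (reach g 6 (t 6) + b) (reach g₁₈ 18 (t 18) + c)
  go₆ true  a b c = ↭-trans (extra-resp (present g₁₈ 18) (multi-6 (t 6 * 6) a b c)) (go₁₈ g₁₈ a (t 6 * 6 + b) c)
  go₆ false a b c = go₁₈ g₁₈ a b c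
  go₁ : ∀ g → extra t (gains g g₆ g₁₈) (multi a b c) ↭
        multi (reach g 1 (t 1) + a) (reach g₆ 6 (t 6) + b) (reach g₁₈ 18 (t 18) + c)
  go₁ true  = ↭-trans (extra-resp (present g₆ 6 ++ present g₁₈ 18) (multi-1 (t 1 * 1) a b c)) (go₆ g₆ (t 1 * 1 + a) b c)
  go₁ false = go₆ g₆ a b c

gains-distinct : ∀ g₁ g₆ g₁₈ → AllPairs _≢_ (gains g₁ g₆ g₁₈)
gains-distinct true  true  true  = ((λ ()) ∷ (λ ()) ∷ []) ∷ ((λ ()) ∷ []) ∷ [] ∷ []
gains-distinct true  true  false = ((λ ()) ∷ []) ∷ [] ∷ []
gains-distinct true  false true  = ((λ ()) ∷ []) ∷ [] ∷ []
gains-distinct true  false false = [] ∷ []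
gains-distinct false true  true  = ((λ ()) ∷ []) ∷ [] ∷ []
gains-distinct false true  false = [] ∷ []
gains-distinct false false true  = [] ∷ []
gains-distinct false false false = []

-- Certificates and their decidable validity.

isArc? : ∀ s v z i j → Dec (IsArc s v z i j)
isArc? direct v z i j = i + z ≟ j
isArc? wrap   v z i j = i + z ≟ v + j

avoids? : ∀ s m i j → Dec (Avoids s m i j)
avoids? direct m i j = j <? m ⊎-dec m ≤? i
avoids? wrap   m i j = j <? m ×-dec m ≤? i

meets? : ∀ s m i j → Dec (Meets s m i j)
meets? direct m i j = i <? m ×-dec m ≤? j
meets? wrap   m i j = i <? m ×-dec j <? m

cutArc? : ∀ v c o s i j → Dec (CutArc v c o s i j)
cutArc? v c nothing  s i j = avoids? s (pos c) i j
cutArc? v c (just σ) s i j = meets? s (pos c) i j ×-dec (pos c ≤? q ×-dec q <? pos c + gain c)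
  where q = slot σ s v (gain c) i j

arcStep? : ∀ v u st → Dec (ArcStep v u st)
arcStep? v u (step forth z s μ w) = isArc? s v z u w
arcStep? v u (step back  z s μ w) = isArc? s v z w u

cutStep? : ∀ v c u st → Dec (CutStep v c u st)
cutStep? v c u (step forth z s μ w) = cutArc? v c (sideAt (gain c) μ) s u w
cutStep? v c u (step back  z s μ w) = cutArc? v c (sideAt (gain c) μ) s w u

walk? : {P : ℕ → Step → Set} → (∀ u st → Dec (P u st)) → ∀ u sts → Dec (Walk P u sts)
walk? P? u []         = yes tt
walk? P? u (st ∷ sts) = P? u st ×-dec walk? P? (target st) sts

allowed? : ∀ z → Dec (Allowed z)
allowed? z = z ≟ 1 ⊎-dec z ≟ 6 ⊎-dec z ≟ 18

-- The multiplicities are stored as data and tied to the walk by `Valid`, so that testing which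
-- boxes a certificate serves takes only them and the cut positions.
record Certificate : Set where
  constructor certificate
  field
    size first          : ℕ
    pos₁ pos₆ pos₁₈     : ℕ
    walk                : List Step
    count₁ count₆ count₁₈ : ℕ
open Certificate

-- The gap between the last label and 0 is written as position `v`, which frees 0 to mean that there
-- is no cut.
cutAt : ℕ → ℕ → List Cut
cutAt x m = if 0 <ᵇ m then cut x m ∷ [] else []

cuts : ℕ → ℕ → ℕ → List Cut
cuts m₁ m₆ m₁₈ = cutAt 1 m₁ ++ cutAt 6 m₆ ++ cutAt 18 m₁₈

cutsOf : Certificate → List Cut
cutsOf d = cuts (pos₁ d) (pos₆ d) (pos₁₈ d)

-- Windows and `upTo` are increasing lists, so each required permutation can be tested as an
-- equality after sorting.
Valid : Certificate → Set
Valid d =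
  Walk (ArcStep (size d)) (first d) (walk d) ×
  All (λ c → (Walk (CutStep (size d) c) (first d) (walk d) ×
              sort (slots (size d) (gain c) (first d) (walk d)) ≡ window c) × pos c ≤ size d) (cutsOf d) ×
  sort (vertices (first d) (walk d)) ≡ upTo (size d) ×
  All Allowed (map len (walk d)) ×
  count₁ d ≡ count 1 (map len (walk d)) × count₆ d ≡ count 6 (map len (walk d)) ×
  count₁₈ d ≡ count 18 (map len (walk d))

valid? : ∀ d → Dec (Valid d)
valid? d =
  walk? (arcStep? (size d)) (first d) (walk d) ×-dec
  All.all? (λ c → (walk? (cutStep? (size d) c) (first d) (walk d) ×-dec
                   ≡-dec _≟_ (sort (slots (size d) (gain c) (first d) (walk d))) (window c)) ×-dec
                  pos c ≤? size d) (cutsOf d) ×-dec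
  ≡-dec _≟_ (sort (vertices (first d) (walk d))) (upTo (size d)) ×-dec
  All.all? allowed? (map len (walk d)) ×-dec
  count₁ d ≟ count 1 (map len (walk d)) ×-dec count₆ d ≟ count 6 (map len (walk d)) ×-dec
  count₁₈ d ≟ count 18 (map len (walk d))

sorted⇒↭ : ∀ {xs ys} → sort xs ≡ ys → xs ↭ ys
sorted⇒↭ {xs} refl = ↭-sym (sort-↭ xs)

valid⇒growable : ∀ d → Valid d → Growable (size d) (cutsOf d) (multi (count₁ d) (count₆ d) (count₁₈ d))
valid⇒growable (certificate v u m₁ m₆ m₁₈ sts _ _ _) (arcs , cuts , covers , allowed , refl , refl , refl) = record
  { origin  = u
  ; steps   = sts
  ; arcs    = arcs
  ; filled  = All.map (λ { ((w , e) , _) → w , sorted⇒↭ e }) cuts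
  ; inside  = All.map proj₂ cuts
  ; covers  = sorted⇒↭ covers
  ; lengths = ↭-multi allowed
  }

gains-cuts : ∀ m₁ m₆ m₁₈ → map gain (cuts m₁ m₆ m₁₈) ≡ gains (0 <ᵇ m₁) (0 <ᵇ m₆) (0 <ᵇ m₁₈)
gains-cuts zero    zero    zero    = refl
gains-cuts zero    zero    (suc _) = refl
gains-cuts zero    (suc _) zero    = refl
gains-cuts zero    (suc _) (suc _) = refl
gains-cuts (suc _) zero    zero    = refl
gains-cuts (suc _) zero    (suc _) = refl
gains-cuts (suc _) (suc _) zero    = refl
gains-cuts (suc _) (suc _) (suc _) = refl

valid-extend : ∀ d → Valid d → ∀ t₁ t₆ t₁₈ → ∃ λ v → Growable v []
  (multi (reach (0 <ᵇ pos₁ d) 1 t₁ + count₁ d) (reach (0 <ᵇ pos₆ d) 6 t₆ + count₆ d)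
         (reach (0 <ᵇ pos₁₈ d) 18 t₁₈ + count₁₈ d))
valid-extend d valid t₁ t₆ t₁₈
  with growable-extra t _ (gains-cuts (pos₁ d) (pos₆ d) (pos₁₈ d)) (gains-distinct (0 <ᵇ pos₁ d) (0 <ᵇ pos₆ d) (0 <ᵇ pos₁₈ d))
         (valid⇒growable d valid)
  where
  t : ℕ → ℕ
  t 1 = t₁
  t 6 = t₆
  -- The only other gain that occurs is 18.
  t _ = t₁₈
... | v , g = v , growable-↭ (extra-multi _ (0 <ᵇ pos₁ d) (0 <ᵇ pos₆ d) (0 <ᵇ pos₁₈ d) (count₁ d) (count₆ d) (count₁₈ d)) g

-- Decoding certificates from numbers.

-- Only the first cut not avoided is recorded. An arc that crosses a second one is then rejected by
-- `valid?`, which requires it to avoid every cut it is not marked for.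
markFor : List Cut → Side → Span → ℕ → ℕ → Mark
markFor []       σ s i j = none
markFor (c ∷ cs) σ s i j = if does (avoids? s (pos c) i j) then markFor cs σ s i j else at (gain c) σ

lenFor : ℕ → ℕ
lenFor 0 = 1
lenFor 1 = 6
lenFor _ = 18

sideFor : ℕ → Side
sideFor 0 = tail
sideFor _ = head

-- Nothing is proved about decoding: valid? checks its output.
forthStep backStep : ℕ → List Cut → Side → ℕ → ℕ → Step
forthStep v cs σ u z = if u + z <ᵇ v then to direct (u + z) else to wrap (u + z ∸ v)
  where
  to : Span → ℕ → Step
  to s w = step forth z s (markFor cs σ s u w) w
backStep v cs σ u z = if z ≤ᵇ u then to direct (u ∸ z) else to wrap (v + u ∸ z)
  where
  to : Span → ℕ → Step
  to s w = step back z s (markFor cs σ s w u) w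

decodeStep : ℕ → List Cut → ℕ → ℕ → Step
decodeStep v cs u k = (if k / 2 % 2 ≡ᵇ 0 then forthStep else backStep) v cs (sideFor (k % 2)) u (lenFor (k / 4))

decodeWalk : ℕ → List Cut → ℕ → ℕ → ℕ → List Step
decodeWalk v cs zero    k u = []
decodeWalk v cs (suc n) k u = follow (decodeStep v cs u (k % 12))
  where
  follow : Step → List Step
  follow st = st ∷ decodeWalk v cs n (k / 12) (target st)

-- In base 64 the lowest digits are v, the first vertex and the positions of the cuts for 1, 6 and 18
-- (0 if there is none).  The rest is the walk in base 12: a digit 4k + 2d + s selects the length (k),
-- the orientation of the arc along the walk (d) and the slot, should the arc cross a cut (s).
decode : ℕ → Certificate
decode k = header (k % 64) (k / 64 % 64) (k / 64 ^ 2 % 64) (k / 64 ^ 3 % 64) (k / 64 ^ 4 % 64)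
  where
  counted : ℕ → ℕ → ℕ → ℕ → ℕ → List Step → List ℕ → Certificate
  counted v u m₁ m₆ m₁₈ sts ls = certificate v u m₁ m₆ m₁₈ sts (count 1 ls) (count 6 ls) (count 18 ls)
  walked : ℕ → ℕ → ℕ → ℕ → ℕ → List Step → Certificate
  walked v u m₁ m₆ m₁₈ sts = counted v u m₁ m₆ m₁₈ sts (map len sts)
  header : ℕ → ℕ → ℕ → ℕ → ℕ → Certificate
  header v u m₁ m₆ m₁₈ = walked v u m₁ m₆ m₁₈ (decodeWalk v (cuts m₁ m₆ m₁₈) (v ∸ 1) (k / 64 ^ 5) u)

-- Boxes of multiplicities and which certificates serve them.

-- exact k stands for {k}, and beyond k for {k, k + x, k + 2x, …}, where x is the step at hand.
data Range : Set where
  exact beyond : ℕ → Range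

least : Range → ℕ
least (exact k)  = k
least (beyond k) = k

_∈[_]_ : ℕ → ℕ → Range → Set
n ∈[ x ] exact k  = n ≡ k
n ∈[ x ] beyond k = ∃ λ t → n ≡ t * x + k

-- The values start at 1, as each of the three lengths must occur. The last `x` entries are tails,
-- one for each residue modulo `x`.
ranges : ℕ → ℕ → List Range
ranges N x = map exact (applyUpTo suc N) ++ map beyond (applyUpTo (suc N +_) x)

ranges-cover : ∀ N x .{{_ : NonZero x}} n → 0 < n → Any (n ∈[ x ]_) (ranges N x)
ranges-cover N x (suc n) _ with n <? N
... | yes n<N = Any.++⁺ˡ (Any.map⁺ (Any.applyUpTo⁺ suc refl n<N))
... | no  n≮N = Any.++⁺ʳ (map exact (applyUpTo suc N))
                  (Any.map⁺ (Any.applyUpTo⁺ (suc N +_) (d / x , eq) (m%n<n d x)))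
  where
  -- The excess over the first tail's start `suc N`: its remainder modulo `x` selects the tail, its
  -- quotient the place in it.
  d = n ∸ N
  open ≡-Reasoning
  eq : suc n ≡ d / x * x + (suc N + d % x)
  eq = begin
    suc n                         ≡⟨ cong suc (m+[n∸m]≡n (≮⇒≥ n≮N)) ⟨
    suc N + d                     ≡⟨ cong (suc N +_) (m≡m%n+[m/n]*n d x) ⟩
    suc N + (d % x + d / x * x)   ≡⟨ +-assoc (suc N) (d % x) _ ⟨
    suc N + d % x + d / x * x     ≡⟨ +-comm (suc N + d % x) _ ⟩
    d / x * x + (suc N + d % x)   ∎

-- With a cut, reaching the least member of a tail suffices, because further rounds reach the
-- others. Without a cut no tail can be served, only the value `b` itself.
Fits : Bool → ℕ → ℕ → Range → Set
Fits true  x b r          = b ≤ least r × x ∣ least r ∸ b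
Fits false x b (exact k)  = k ≡ b
Fits false x b (beyond k) = ⊥

fits? : ∀ g x b r → Dec (Fits g x b r)
fits? true  x b r          = b ≤? least r ×-dec x ∣? (least r ∸ b)
fits? false x b (exact k)  = k ≟ b
fits? false x b (beyond k) = no id

fits⇒reach : ∀ g x b r {n} → Fits g x b r → n ∈[ x ] r → ∃ λ t → n ≡ reach g x t + b
fits⇒reach true x b (exact k) (b≤k , divides q e) refl = q , trans (sym (m∸n+n≡m b≤k)) (cong (_+ b) e)
fits⇒reach true x b (beyond k) (b≤k , divides q e) (t , refl) = t + q , (begin
  t * x + k             ≡⟨ cong (t * x +_) (m∸n+n≡m b≤k) ⟨
  t * x + (k ∸ b + b)   ≡⟨ cong (λ d → t * x + (d + b)) e ⟩
  t * x + (q * x + b)   ≡⟨ +-assoc (t * x) (q * x) b ⟨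
  t * x + q * x + b     ≡⟨ cong (_+ b) (*-distribʳ-+ x t q) ⟨
  (t + q) * x + b       ∎)
  where open ≡-Reasoning
fits⇒reach false x b (exact k) refl refl = 0 , refl

Covering : Range → Range → Range → Certificate → Set
Covering r₁ r₆ r₁₈ d =
  Fits (0 <ᵇ pos₁₈ d) 18 (count₁₈ d) r₁₈ × Fits (0 <ᵇ pos₆ d) 6 (count₆ d) r₆ × Fits (0 <ᵇ pos₁ d) 1 (count₁ d) r₁

covering? : ∀ r₁ r₆ r₁₈ d → Dec (Covering r₁ r₆ r₁₈ d)
covering? r₁ r₆ r₁₈ d =
  fits? (0 <ᵇ pos₁₈ d) 18 (count₁₈ d) r₁₈ ×-dec fits? (0 <ᵇ pos₆ d) 6 (count₆ d) r₆ ×-dec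
  fits? (0 <ᵇ pos₁ d) 1 (count₁ d) r₁

order : Range → Range → Range → ℕ
order r₁ r₆ r₁₈ = suc (least r₁ + (least r₆ + least r₁₈))

-- Adding arcs of length 6 or 18 in multiples of 6 or 18 preserves the order modulo 2 and 3, but adding
-- single arcs of length 1 does not: hence nothing is excluded when r₁ is unbounded.
Inadmissible : Range → Range → Range → Set
Inadmissible (beyond _) r₆ r₁₈ = ⊥
Inadmissible r₁@(exact _) r₆@(exact _) r₁₈@(exact _) =
  order r₁ r₆ r₁₈ < 36 ⊎ 2 ∣ order r₁ r₆ r₁₈ ⊎ 3 ∣ order r₁ r₆ r₁₈
Inadmissible r₁@(exact _) r₆ r₁₈ = 2 ∣ order r₁ r₆ r₁₈ ⊎ 3 ∣ order r₁ r₆ r₁₈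

inadmissible? : ∀ r₁ r₆ r₁₈ → Dec (Inadmissible r₁ r₆ r₁₈)
inadmissible? (beyond _) r₆ r₁₈ = no id
inadmissible? r₁@(exact _) r₆@(exact _) r₁₈@(exact _) =
  order r₁ r₆ r₁₈ <? 36 ⊎-dec 2 ∣? order r₁ r₆ r₁₈ ⊎-dec 3 ∣? order r₁ r₆ r₁₈
inadmissible? r₁@(exact _) r₆@(exact _) r₁₈@(beyond _) = 2 ∣? order r₁ r₆ r₁₈ ⊎-dec 3 ∣? order r₁ r₆ r₁₈
inadmissible? r₁@(exact _) r₆@(beyond _) r₁₈ = 2 ∣? order r₁ r₆ r₁₈ ⊎-dec 3 ∣? order r₁ r₆ r₁₈

at-index : {A : Set} → ℕ → List (List A) → List A
at-index n       []         = []
at-index zero    (xs ∷ xss) = xs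
at-index (suc n) (xs ∷ xss) = at-index n xss

at-index-All : {A : Set} {P : A → Set} → ∀ n {xss} → All (All P) xss → All P (at-index n xss)
at-index-All n       []         = []
at-index-All zero    (ps ∷ pss) = ps
at-index-All (suc n) (ps ∷ pss) = at-index-All n pss

-- Certificates with n₆ arcs of length 6 and n₁₈ of length 18 are filed in row n₁₈ mod 18, column n₆ mod 6.
cell : List (List (List Certificate)) → Range → Range → List Certificate
cell tbl r₆ r₁₈ = at-index (least r₆ % 6) (at-index (least r₁₈ % 18) tbl)

Covered : List (List (List Certificate)) → List Range → List Range → List Range → Set
Covered tbl rs₁ rs₆ rs₁₈ = All (λ r₁₈ → All (λ r₆ → All (λ r₁ →
  Inadmissible r₁ r₆ r₁₈ ⊎ Any (Covering r₁ r₆ r₁₈) (cell tbl r₆ r₁₈)) rs₁) rs₆) rs₁₈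

covered? : ∀ tbl rs₁ rs₆ rs₁₈ → Dec (Covered tbl rs₁ rs₆ rs₁₈)
covered? tbl rs₁ rs₆ rs₁₈ = All.all? (λ r₁₈ → All.all? (λ r₆ → All.all? (λ r₁ →
  inadmissible? r₁ r₆ r₁₈ ⊎-dec Any.any? (covering? r₁ r₆ r₁₈) (cell tbl r₆ r₁₈)) rs₁) rs₆) rs₁₈

-- The actual order exceeds that of the least members by a multiple of 6 plus a multiple of 18,
-- hence by a multiple of `k`. It is applied with `k` equal to 2 and 3.
∣-order : ∀ {k b c} a r₆ r₁₈ → k ∣ 6 → b ∈[ 6 ] r₆ → c ∈[ 18 ] r₁₈ →
          k ∣ suc (a + (least r₆ + least r₁₈)) → k ∣ suc (a + (b + c))
∣-order {k} a r₆ r₁₈ k∣6 b∈ c∈ p with excess r₆ b∈ | excess r₁₈ c∈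
  where
  excess : ∀ {n x} r → n ∈[ x ] r → ∃ λ t → n ≡ t * x + least r
  excess (exact k)  refl = 0 , refl
  excess (beyond k) e    = e
... | t , refl | s , refl = subst (k ∣_) eq
  (∣m∣n⇒∣m+n (∣m∣n⇒∣m+n (∣n⇒∣m*n t k∣6) (∣n⇒∣m*n s (∣-trans k∣6 (divides 3 refl)))) p)
  where
  open +-*-Solver
  eq : t * 6 + s * 18 + suc (a + (least r₆ + least r₁₈)) ≡ suc (a + (t * 6 + least r₆ + (s * 18 + least r₁₈)))
  eq = solve 5 (λ x y a b c → x :+ y :+ (con 1 :+ (a :+ (b :+ c))) := con 1 :+ (a :+ (x :+ b :+ (y :+ c)))) refl
         (t * 6) (s * 18) a (least r₆) (least r₁₈)

admissible : ∀ {a b c r₁ r₆ r₁₈} → a ∈[ 1 ] r₁ → b ∈[ 6 ] r₆ → c ∈[ 18 ] r₁₈ →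
             36 ≤ suc (a + (b + c)) → ¬ (2 ∣ suc (a + (b + c))) → ¬ (3 ∣ suc (a + (b + c))) →
             ¬ Inadmissible r₁ r₆ r₁₈
admissible {r₁ = exact _} {exact _} {exact _} refl refl refl 36≤ ¬2 ¬3 (inj₁ <36)        = <⇒≱ <36 36≤
admissible {r₁ = exact _} {exact _} {exact _} refl refl refl 36≤ ¬2 ¬3 (inj₂ (inj₁ p)) = ¬2 p
admissible {r₁ = exact _} {exact _} {exact _} refl refl refl 36≤ ¬2 ¬3 (inj₂ (inj₂ p)) = ¬3 p
admissible {r₁ = exact a} {exact k} {beyond l} refl b∈ c∈ 36≤ ¬2 ¬3 (inj₁ p) =
  ¬2 (∣-order a (exact k) (beyond l) (divides 3 refl) b∈ c∈ p)
admissible {r₁ = exact a} {exact k} {beyond l} refl b∈ c∈ 36≤ ¬2 ¬3 (inj₂ p) =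
  ¬3 (∣-order a (exact k) (beyond l) (divides 2 refl) b∈ c∈ p)
admissible {r₁ = exact a} {beyond k} {r₁₈} refl b∈ c∈ 36≤ ¬2 ¬3 (inj₁ p) =
  ¬2 (∣-order a (beyond k) r₁₈ (divides 3 refl) b∈ c∈ p)
admissible {r₁ = exact a} {beyond k} {r₁₈} refl b∈ c∈ 36≤ ¬2 ¬3 (inj₂ p) =
  ¬3 (∣-order a (beyond k) r₁₈ (divides 2 refl) b∈ c∈ p)

covering⇒growable : ∀ {r₁ r₆ r₁₈ a b c} d → Valid d → Covering r₁ r₆ r₁₈ d →
                    a ∈[ 1 ] r₁ → b ∈[ 6 ] r₆ → c ∈[ 18 ] r₁₈ → ∃ λ v → Growable v [] (multi a b c)
covering⇒growable {r₁} {r₆} {r₁₈} d valid (f₁₈ , f₆ , f₁) a∈ b∈ c∈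
  with fits⇒reach _ _ _ r₁ f₁ a∈ | fits⇒reach _ _ _ r₆ f₆ b∈ | fits⇒reach _ _ _ r₁₈ f₁₈ c∈
... | t₁ , refl | t₆ , refl | t₁₈ , refl = valid-extend d valid t₁ t₆ t₁₈

find-both : {A : Set} {P Q : A → Set} {xs : List A} → All P xs → Any Q xs → ∃ λ x → P x × Q x
find-both ps i = _ , All.lookupAny ps i

growable-multi : ∀ {tbl rs₁ rs₆ rs₁₈} → All (All (All Valid)) tbl → Covered tbl rs₁ rs₆ rs₁₈ → ∀ {a b c} →
                 Any (a ∈[ 1 ]_) rs₁ → Any (b ∈[ 6 ]_) rs₆ → Any (c ∈[ 18 ]_) rs₁₈ →
                 36 ≤ suc (a + (b + c)) → ¬ (2 ∣ suc (a + (b + c))) → ¬ (3 ∣ suc (a + (b + c))) →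
                 ∃ λ v → Growable v [] (multi a b c)
growable-multi valid covered a∈ b∈ c∈ 36≤ ¬2 ¬3 with find-both covered c∈
... | r₁₈ , covered₁₈ , c∈r with find-both covered₁₈ b∈
... | r₆ , covered₆ , b∈r with find-both covered₆ a∈
... | r₁ , inj₁ bad , a∈r = contradiction bad (admissible a∈r b∈r c∈r 36≤ ¬2 ¬3)
-- Soundness does not depend on the filing of certificates: all entries of the table are valid, so
-- the cell merely narrows the search.
... | r₁ , inj₂ cover , a∈r with find-both (at-index-All (least r₆ % 6) (at-index-All (least r₁₈ % 18) valid)) cover
... | d , valid-d , covering = covering⇒growable d valid-d covering a∈r b∈r c∈r

-- Membership in the support enters the covering argument through this positivity, since `ranges`
-- starts at 1.
count-∈ : ∀ {z ls} → z ∈ ls → 0 < count z ls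
count-∈ {z} {y ∷ ls} z∈ with y ≡ᵇ z | ≡⇒≡ᵇ y z
... | true  | _ = z<s
count-∈ (here refl) | false | f = contradiction refl f
count-∈ (there z∈)  | false | _ = count-∈ z∈

length-multi : ∀ a b c → length (multi a b c) ≡ a + (b + c)
length-multi a b c = trans (length-++ (replicate a 1)) (cong₂ _+_ (length-replicate a)
  (trans (length-++ (replicate b 6)) (cong₂ _+_ (length-replicate b) (length-replicate c))))

-- Found by simulated annealing on Hamiltonian paths, followed by a greedy choice of a subset that covers.
codes : List (List (List ℕ))
codes =
  ((55809283762294273535591285054054165639510675940 ∷
    4429030775618941238974306229473019996739264611 ∷
    3816643302481396755078744808548291990394503587 ∷
    220764076622913162416136760759760232907999 ∷
    1286438874657153850793957987869555426845 ∷ []) ∷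
   (669751189574290370851346576622770806219472475685 ∷
    113586713330652218822930203311421602896036516360426884491603703733 ∷
    3554230340946787788743330867764949480756860835 ∷
    2894552050427144168336106223372296421001134115 ∷
    4576355535286066528455829511372971856590069859 ∷
    220759950865324338803875131719032973558815 ∷
    6128906013562812525454017055560717015131534917179343485798449 ∷
    14346861008801948982901192451591806329008429052463209 ∷
    1600715705553141266962625456954041958429 ∷
    19397109154086349808508179044106457 ∷
    1281312683900152967483322105888715572509 ∷ []) ∷
   (669750679812367345092331292684058428846438454757 ∷
    128235517600813024301753924279476667281640939153919581465175004917 ∷
    3628149359797675067575705002612868986130257955 ∷
    3871740322436311849643208398192130066171298275 ∷
    3628152924222543645064227763732234918143517859 ∷
    231087063516259924186232878174894147765279 ∷
    4849757942169976744969154690126866505977603489011558293963697 ∷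
    14346832820850034633496653006654466143992865968095401 ∷
    867438457910721103836714588300820611613 ∷
    77392377093393736946706911005245465 ∷
    1598662477165104396738938532892696904285 ∷ []) ∷
   (55790974204941124238062960362329905407690592292 ∷
    3554230414865388399067966565034830182922380195 ∷
    220760020896793123530198131088460959188063 ∷
    4429929168563076669979259544042960076308743715 ∷
    4577838796946596826342419145210734384159130851 ∷
    6128908278282558649827148819833669149559519265878548038551985 ∷
    11477477499895635779619515127521637098962713271339433 ∷
    1237980607440765875518364738970942702109 ∷
    77597737930862740026894230830973529 ∷
    1239476060051921328927122912052500236061 ∷ []) ∷
   (43537835090670523723215251524948444262267671588 ∷
    4502949769203546251656524834466116621891068451 ∷
    231091202243592713171818689733019544585311 ∷
    3668979630322211886784404512213790285485310691 ∷
    56747411678465583866236960624016845177759 ∷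
    61887922147616134023154048545326617 ∷
    1533111041137082051491275725919183962397 ∷ []) ∷
   (44424757120570960840692463752645566537040188324 ∷
    4650773622103735938524906843302402699561066595 ∷
    142293806896173419671996613112418595767263 ∷
    3774960769199903604624552115399874197760508131 ∷
    231087063497099783912096704247749666145503 ∷
    77392424315049617444210949081792921 ∷
    1609066307575017705512436985837052232925 ∷ []) ∷ []) ∷
  ((669710895385608256874047654772038475942682485157 ∷
    16638193163204335754508380996950 ∷
    522453507810694508018529560764359014489164403557 ∷
    3774463129295392399231680806567325321002483747 ∷
    46559503380503933850829864277713369 ∷
    8981415784398963421615920579734 ∷
    306116356772029847271849934455959 ∷
    142999925715797109999041867839373722518623 ∷
    4576816081562168259135177986214565372894905891 ∷
    1609023980852474531201632496930493825373 ∷ []) ∷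
   (533097340327897208470150120059439630730440528805 ∷
    25505298864838089014139434894358 ∷
    1591821015825063109188252360431033117688626046571705515 ∷
    424072901368099992700766849202369031729596924133 ∷
    4841682442947398924529919378908794628143056419 ∷
    543742649249678589783271421378240987873031550181 ∷
    25505226968649585820485910332566 ∷
    46641832021548910088330954395690265 ∷
    19490854389531219776992543768 ∷
    323329885293702254625614416576727 ∷
    185296364496783056915266918958783998198239 ∷
    3871740338338281324316708805038504471857463971 ∷
    6168611893144549324293973147612879940483916574183223279748401 ∷
    707333714250128672343431229811149330941591267891116391750960629 ∷
    11477492394577922370163266731403013492962252971574505 ∷
    1239476061425700552389114520939614176413 ∷
    62047153848097361722881197408780633 ∷
    1508030873975593976029220985746552260253 ∷ []) ∷
   (669565606157349665788171252871946442962157490725 ∷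
    17958439623985201498127125251414 ∷
    637779412091870315379157976656203214466312118629 ∷
    224307546942877459517829531986574330824159 ∷
    4504056849444777053259986787731915181979600611 ∷
    4649251822841337615652723977640893262944798307 ∷
    1388046109788235422898153127958 ∷
    1293485863183905987816669958996568 ∷
    44189775086549000575380299144495641 ∷
    306864011508763462977118122279127 ∷
    4904386858922222813271430415030349701740019025468915973620849 ∷
    117971317312333873444652465617804053106466713395768430773091437557 ∷
    14346865493091123740124551616112821356465508071768169 ∷
    1287264219072056040150855239170428764637 ∷
    77195010084581357888005777618109593 ∷
    1279266436146268514221919653851826225245 ∷ []) ∷
   (601659541978544877229482318362057912733381269221 ∷
    26934194943507240433484637471510 ∷
    182635925615137099919350323214409888473517453925 ∷
    220760023076756913211627137290688355894751 ∷
    4502946223722246676261152458724332330426041571 ∷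
    17337764732364913086675136611414 ∷
    1293338234962860508037408677265816 ∷
    46559503482715847570951224789565721 ∷
    4927971598065879986516941781590683565674877345001852238299633 ∷
    2710636728503506346937075025063703428330948707 ∷
    47852821471872157975450002256823193 ∷
    1287235732372348637588880769517627639005 ∷ []) ∷
   (532950998925419948281495483591271759055080445029 ∷
    26991800938386286822594006549782 ∷
    522453507856054085411149140247903626149304005669 ∷
    231633576961837937788033935138492912240031 ∷
    3629218200026181939702109242490626762475045027 ∷
    25451759268016414515993924666198 ∷
    46559503482773554888256036930847257 ∷
    213687951162031509558338439236419008594847 ∷
    4502942714288585120135504183024018265794414115 ∷
    62079336027945698644998546197054553 ∷
    1281312684587863321175223594905736578269 ∷ []) ∷
   (669750679812367345089949077469941536792970892773 ∷
    215501275487824283612807304095127 ∷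
    511809169095824109674371434975499377719326331749 ∷
    4569127123406161020616881451187882660683318499 ∷
    9095765595924399713068173034518 ∷
    142999925715797109999031011726852049339935 ∷
    4431282247699641719558608737991258762618864931 ∷
    1239646490690038213510231183680778272797 ∷ []) ∷ []) ∷
  ((8036536861771399698210363744422450798245282898342 ∷
    26834340179158375617030100943382 ∷
    691850792337421832018843279771445614154459706085 ∷
    538237001369465209186850648885272410766356776485 ∷
    4804725236654626165998739191138228466872747619 ∷
    31033493925094822006864835233784985 ∷
    24702389615885653311339460362454 ∷
    323329890559165744112880240559127 ∷
    3629179261856782783919534010871945842148246243 ∷
    1287121449611863700056541558772345078429 ∷
    230701923292533262838919650627324152382879 ∷ []) ∷
   (7393373125062253681759938376853864763697985848998 ∷
    26824608128867675088425613591382 ∷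
    553499962438416768991762509644416552901151880613 ∷
    511809169096337441749278959692929128560702072549 ∷
    300250859028012164391127146778633233561704203557 ∷
    4656855752749644695231073832828704518813779939 ∷
    25572336871999599272643891102038 ∷
    1293319637439332420817589358395736 ∷
    46352921324771995408633049766953625 ∷
    323330643984895589200698504118871 ∷
    4502956649306217672829150685005494916431217827 ∷
    101860318651777681276866071738541929589325889706736165533717366709 ∷
    14346865493221219187328033896617556411157389504414953 ∷
    1287271330919255041909897550460268578269 ∷
    62079319351956791910554309366908057 ∷
    178285949115812790336388778155505736483551 ∷
    1279268875554035612609001552256455149213 ∷
    171404528211308820663975685395238151522207 ∷ []) ∷
   (76766017007217369906967688131811635527326173811623 ∷
    26929431126861409018787162293078 ∷
    884405906331742618238938116433958801835509088588968 ∷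
    436347540157358460514307548509478848671435195493 ∷
    543520428183714296562012589199672599355892757925 ∷
    26757053219284061244921487098774 ∷
    33680196385362030287661519963544 ∷
    511809169095824109730753274184726694585901840357 ∷
    46534055465305167640297805923484313 ∷
    4575841836970616077773219201762914926265370211 ∷
    4431291071055565736477421942441015633634658019 ∷
    62079328870019928224965201372382489 ∷
    178605562000748454156547424175440758047455 ∷
    1287235732386078332369800683794563335965 ∷
    230701894823037360964555409331077378999711 ∷ []) ∷
   (1190846772658621345079136533684468898569317724259048 ∷
    42652488423616435557605270160022 ∷
    8033900289846553116661982855266145707936197697638 ∷
    548801533434746641483400049605826544569657065509 ∷
    6237073404683213395385191564566 ∷
    659069671067221079651529334111374504076570063269 ∷
    522453507810694508074911399973586331355739912165 ∷
    46649317339800510049865678813660185 ∷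
    4656845061110594502666934878013016927111743651 ∷
    3630245139441959995202031676365324292459070115 ∷
    42032885019434509530317085590159641 ∷
    184804682203015756626269327571704474501151 ∷
    1598662477189490150973314641073910318301 ∷
    100399535547699073580965475083953243162527 ∷ []) ∷
   (6181709992036419715476648543943751349101269591336297 ∷
    511887037014675715646628323713751 ∷
    6141721914404328290097118741630239265679660344230 ∷
    17671707979874263845051527922966 ∷
    669710895385608256667288887601230119969920971557 ∷
    648424257003559538201882423910629659279886446757 ∷
    3629218200026181939702107475345602400206979683 ∷
    4804729019539663993668299723197128362852615843 ∷
    1286434223772010456691458554535172113053 ∷
    142887267269657973140976480231643307575199 ∷ []) ∷
   (8036536819288166370642016787862929023627846017126 ∷
    26834340178923973079305582870742 ∷
    669491690828674016311168433621604636727936348325 ∷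
    370282317966679050763269795604955522712637539429 ∷
    4575835129259890049853674678752795847962395875 ∷
    30851049529735065956462091846362457 ∷
    2120605013713915080723075237078 ∷
    215553342530517153503237350622295 ∷
    4576348429317226174172413639246387047249217187 ∷
    1602438427869524316236926045396282638365 ∷
    224550991242271683808111565856655194195743 ∷ []) ∷ []) ∷
  ((78298924669823415588034759088780048630245907297383 ∷
    42603551692636501428220653535894 ∷
    96443730864543475253335326562558692620416775722471 ∷
    549032446672752273365601271999765836807211844453 ∷
    3880013902139517875918202209676394117577835427 ∷
    2768134456635440661846996616342 ∷
    31025262575460417753941941426586521 ∷
    323329885297059750278352168812695 ∷
    371161224489157564105164236708652878856672509989 ∷
    3630414451080964605595613146336177297719558819 ∷
    992176263843699819469737057419526144797 ∷
    185367754524915049637134831348298815636895 ∷ []) ∷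
   (96438368935527588989862862520928748830816961097895 ∷
    17962373926037706718313813967894 ∷
    950503027746253097320844184720370331882961309078952 ∷
    538310419244674062434592700171682256100297802789 ∷
    41164753884147765910875779170326 ∷
    88718730971422229183211435158439529978190258870247 ∷
    1679747830374994935646849069056792 ∷
    33519155149780717680337035773346457 ∷
    370279846124432365634465201702443329083364606053 ∷
    3605095690646929132436139378581429071800173989 ∷
    3628671303197476144184175636527155731937886883 ∷
    1095653075396489691707043175110308496373450531 ∷
    62079337976859081898473922381218393 ∷
    183919693387049834237599509666053079695967 ∷
    1286439077736261339404571454964703953885 ∷
    230208064035984509503160528183687659913247 ∷ []) ∷
   (1064645730008960360749201060515080134592050928654184 ∷
    26992559187719696913214014555478 ∷
    93373020116146251858007885024336983486040810292647 ∷
    558827309913676095372318775285088771804858942949 ∷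
    33909018414071702539015619675478 ∷
    93399372253497097068908945504993977499566015092199 ∷
    46757093968232856388690055151223961 ∷
    548880321746309688215536181320512767701853406373 ∷
    370260875227969648672034125935378998666397745317 ∷
    4649247961452178875159337125962507990174533731 ∷
    3630501697881481360031821635391490481187192867 ∷
    62079331263514202036524983447978713 ∷
    184804697318688253175136765146605492895775 ∷
    1604812965992262108516000701246926226589 ∷
    184509720311851525504503770815048099825247 ∷ []) ∷
   (13887153444419318600715610161718740139096486956573033 ∷
    323844435330752805904618782266647 ∷
    88468794022132743559731461991943851205019655047207 ∷
    42536909800222864038723839394326 ∷
    86649431288672450018743091051831426031774881388647 ∷
    151767776793643097107475960946202752165915919781 ∷
    648423761205858403114876529953912713271563519141 ∷
    4649757638765411698782630459792816829784130851 ∷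
    3554246086625913607041048148129320268034736163 ∷
    1602267208857425084897601952856817008669 ∷
    224235826548062605446814349045495324739039 ∷ []) ∷
   (96443730864543477616191020940696964700467096557031 ∷
    26824254593511329757417180823766 ∷
    93378309145642550466951838885793897788113779787047 ∷
    548881075930303302989346353661798460725181810085 ∷
    3702075041167496951127101507182823420107162147 ∷
    42894988967325735555243982157325593 ∷
    42085410775976452218487339287510 ∷
    323953678303328311766074219299927 ∷
    656492304711415635245686441920803067542715761957 ∷
    809520053982209149422206134696650065689707363 ∷
    1598638658553801784621588962718605378781 ∷
    231584591531446490995019165060331888182879 ∷ []) ∷
   (88718727912855791049857629416560431883428892866279 ∷
    27524954490004415632401935959062 ∷
    93378378218359985747261880569159141452288598578663 ∷
    538310411563744842252274461535687409497392022629 ∷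
    4569225380094581667648539922460952438887679267 ∷
    73711733329958408129955476229398553 ∷
    26820617834232821812607525126550 ∷
    323953678303328311771303341983127 ∷
    687373683518148576071385566180409005293597885733 ∷
    3630245148064336979915396638463227149723107555 ∷
    1600474963049214921760213867235087745309 ∷
    15441363732188087407723262680476181071071 ∷ []) ∷ []) ∷
  ((1157332310362602372724992910763337506298272735135208 ∷
    26998117455975134709060566844502 ∷
    902925631803014539385630691092123700278027863266600 ∷
    670587221883078752775669645060887621095218742821 ∷
    8981819258572426320693704590614 ∷
    46665773651643649364533658188514777 ∷
    548806932336912091961698958829670782173041656165 ∷
    3629218200372476985775279301799508789808333923 ∷
    185367899119518803223868680977411081241567 ∷ []) ∷
   (1157324770374810442284872072941415892960202475017576 ∷
    42652488460183243955905637188310 ∷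
    884406244219711172061393940040030498462484820984936 ∷
    538237013488933608504496541273832977656802968037 ∷
    102266828605874960932078678 ∷
    921066221461534814943496998416547487913133100045480 ∷
    31023951563975041580754062329250393 ∷
    3738265607232683388156518163043761865720332389 ∷
    558575183391856503530825770120087088616595260325 ∷
    3878491647727063715717277917660987351546463267 ∷
    819440234450589773329744083761014735391687395 ∷
    62079324116868284838274318920058329 ∷
    142840304250497677326675726375520980435743 ∷
    1609093937316792972904804180921285607453 ∷
    174968627545953441108423366059995466565087 ∷ []) ∷
   (11054314879361381773758022243454507093814410480776233 ∷
    215453198549942530255111130518807 ∷
    11047815991440737642963049950938755797449748225271017 ∷
    42086251719952179291290039026198 ∷
    921192632286187410757104004785720822182306817578152 ∷
    371157275191847157630129674281020644157431219557 ∷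
    43091198252494263822460111597503578245468520549 ∷
    4503976715213913109800906932055624038520195107 ∷
    3880748489685396834486086334518203734280372963 ∷
    1287221539258828157654885582045465019741 ∷
    185359828881193061548029901242017758840287 ∷ []) ∷
   (921191763524721026276374014324090815589450887271592 ∷
    26834340178927544714683768963286 ∷
    1189342621721150435097635841231159875845185062113576 ∷
    372633270739427944677357606626385991143036028325 ∷
    4651251581630459370033016422589209462815852067 ∷
    28776883440461828149646194393818521 ∷
    42086251719954949297393525915734 ∷
    215553256868827452928417634976855 ∷
    522453507871943241337067939636846119163348386981 ∷
    3554230414865393095944181575048962718350967651 ∷
    1191178337102473270511665823867052491357 ∷
    175069662577003171843804400750912065242591 ∷ []) ∷
   (921067120816398743469441856332257234002802600645928 ∷
    11059105457724738461742952678550 ∷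
    902925631803010442051896256748611875862919977178280 ∷
    530599470606728843595588120318217720592096035685 ∷
    3880021004526742462786320875701144348531359779 ∷
    31039668963699508325837853698631065 ∷
    24698910445658140713912863621590 ∷
    215553256403566508164027241989527 ∷
    637782021206658004183720682445982101375668454309 ∷
    3554230341285853325623887194476356363990074403 ∷
    1287264219096142924567560000780959219805 ∷
    185363926505654896039100478578694077547871 ∷ []) ∷
   (921191763524721069115827045379805027492672713594152 ∷
    17339366646090179327643772060950 ∷
    1189342621721150435195740175399034511723706728386984 ∷
    372049782294150167090773527718205604827890975653 ∷
    3703907439726885200544664301338597847462314595 ∷
    9035454294644194416357897995414 ∷
    46634910926745224543790450516165529 ∷
    215554285757554772630058804445847 ∷
    687373683513311857373070064319249192381593421541 ∷
    3843788932846591498579856325712702876754117731 ∷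
    1287277062477865048921016924800190251101 ∷
    220669694496388279640368850019291871840159 ∷ []) ∷ []) ∷
  ((11275944428605128954618722622024308964214771661219049 ∷
    323910710252657472339106982597975 ∷
    10833606434459796983464363027255975016430860964275433 ∷
    658923108066993397872142394533516901363610028197 ∷
    510632831078459649685897437057367 ∷
    82109376967271228509831434705569177 ∷
    544593751454090419229552657552647709507046343845 ∷
    4576364678893301532240479361919627381799651107 ∷
    185367669067092020789489939918088547862111 ∷ []) ∷
   (14290162152771793108760301999468234913861127865442409 ∷
    323910710252636375208433314239639 ∷
    14363033726806711009546630052855234925037004805473577 ∷
    107790622096045656577758952494487 ∷
    11270460741189757587988619860491894013395911883695337 ∷
    370282318198491212201519166976084124935167148133 ∷
    558575183392032692437950799921138879842440446565 ∷
    4431275509712875968322632850808301808052078307 ∷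
    3554230341702599726297776144949291874588820515 ∷
    1281312685883788611845668748886571745629 ∷
    231701506677699022003354038922473199633567 ∷ []) ∷
   (11051251377537243443231652411756183458218249471993193 ∷
    17223887149866313373956481815831 ∷
    10612874931394096668860463185343259774953364186277225 ∷
    548806932336907687933674877871865337582438319525 ∷
    4576364742073352548118165880870381682701109091 ∷
    46748055384541089836319231602664857 ∷
    2293723706658861249537087706519 ∷
    339853990962942836642716000716183 ∷
    517470073433692378550060500937320148311725311333 ∷
    4841695734024024736125742622260638164292469923 ∷
    1609093937317947318091390823637025031581 ∷
    217156504049756600500179989850807129343455 ∷ []) ∷
   (11271982955031652146424823271385647003278576271041769 ∷
    323848413498882822077640731333911 ∷
    14272111460100199284584780105574203272614617443804009 ∷
    375212939693168857294838744167323838132093453221 ∷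
    3811159114484737408573115723031648920451155043 ∷
    46649317314984315115686362788210073 ∷
    398631420804149162615385649649047 ∷
    323953592176377666426864110667159 ∷
    512151695656225669278452565845780648439269818533 ∷
    3628149384206818099496214059624781856545178019 ∷
    1609096035920355308900263874351155119901 ∷
    185359857722378387019554765444791150838367 ∷ []) ∷
   (11052784307080936342991466810671016635987752206017897 ∷
    306062756957961408405155631404119 ∷
    10617102299338632020724912196150137543492679424091497 ∷
    532259764611364854295691923251074452014422557925 ∷
    3842804869059753600073947221106005112972116259 ∷
    510632800032603972676098218333143 ∷
    28652864913947152820506213809914457 ∷
    306864016778227082884699523908375 ∷
    648639390426583022603844996706020967573343438373 ∷
    4841695734364267319540271043187964849523525539 ∷
    1602436060280656573872420846295364665437 ∷
    185367754731643713932648137225609735571103 ∷ []) ∷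
   (921066233861488163015085129487688070586477028648169 ∷
    496745209099642371316821400555671 ∷
    6163573073083622094999816632881416048981741024388457 ∷
    424684220126017715288977118043565917695169267557 ∷
    415773275189316602328583503680791 ∷
    31038973387093436013296129419773337 ∷
    691882016330244814218483047749102471682102658597 ∷
    3554245652995446660284097358306081999541502563 ∷
    213638840444739154157795687823533146112159 ∷ []) ∷ []) ∷
  ((10836629796618444787321806904819940263948714459866473 ∷
    5656839829495105370355782291313048 ∷
    18458487385963872627866693301624784931686719358768954824303 ∷
    510632835665505662862637775266647 ∷
    11460619423228753471653110739316012755950016070252137 ∷
    990438331113971655701359454230957805661 ∷
    548806932336912091961710651560400348411867693285 ∷
    4804728823541073889497856770400029565784163171 ∷ []) ∷
   (11052784307080936342991466805156141204036888041432425 ∷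
    496745180779045721178405221507735 ∷
    13445714896728575091673096819500055021578705152079209 ∷
    538310411795557003690523832906816011719921631333 ∷
    8807404311608177302964705447947729034690096189408361 ∷
    73703500059196643347904456923882265 ∷
    505034993045148694552274095907223 ∷
    324711147518064419256790519907031 ∷
    553505488372952519554293755228649595911379615845 ∷
    1600715705787392903223324405758366318685 ∷
    3738778058988413940590964055915535744465110307 ∷
    185359857722378387019556535610182750701343 ∷
    3843775016927316444487114922906713489967941731 ∷ []) ∷
   (14289909331247957468392202152489101282824767747728361 ∷
    398731266834097212406091705296215 ∷
    10833595937966100988979973934544028475422474929775849 ∷
    548880321754235712976728128476675383090817009189 ∷
    13450248996519209248554908359538368161872743350666345 ∷
    31025260591148665921899065973745113 ∷
    505067412155589380550191379980375 ∷
    199230316604059982626866270569559 ∷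
    170382828960740047929655687296157258612958037157 ∷
    1284318037181438126907947413623380379421 ∷
    4804736173979468473833586857832513519658992931 ∷
    231701493768396808761916777736319480627871 ∷
    3841778156937735651378460018426393928799357027 ∷ []) ∷
   (11051283309382046056100283338058961290721432767898857 ∷
    330299743332651771735859376498007 ∷
    10615929855582127887826701555891734351683873190782185 ∷
    659246042147467845005392052004044476112912778597 ∷
    9048156190600850016918751518621798479215298791343209 ∷
    505067412155589381667494909780375 ∷
    46542289167529006361657363006751705 ∷
    199836631226284357454846773428247 ∷
    558827770340124901464401446159793953123969008997 ∷
    871233500151940915043941613834975840029 ∷
    4803705192744204644944186111937673929288582371 ∷
    185367908259470392621392287391706674889247 ∷
    3843787523699349585561060051017414668126783267 ∷ []) ∷
   (11270471385506207209733122278444905640551433889457385 ∷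
    511829861522196071946927235473751 ∷
    10833595937966100989004878437221799675226441610241385 ∷
    658995190050665773819879088800053448459574314853 ∷
    496745178476596095519835366958167 ∷
    46648621738378242803144638509352345 ∷
    424078959541761249655227527508109625213756900965 ∷
    231633206496911911336341719170912389957279 ∷
    4804603759501165053097488783526704105903882275 ∷ []) ∷
   (11051283309382046056100284136804169377376483571213673 ∷
    511829861522198939630974411809559 ∷
    11051251375997323458617913177283515287803694090626409 ∷
    552707902986447637569707254466989467846235915557 ∷
    25452090327691232403537966998743 ∷
    42895224473215731933653858523546969 ∷
    691882016378898295355052836527261602890489792101 ∷
    224307888184325476251086991694572919194783 ∷
    4431031249367665763033753432117622158458356579 ∷ []) ∷ []) ∷
  ((1967532725235852198344128507715746536119696264537150699 ∷
    47563165237168225615330599112090969 ∷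
    127354880586675120562036874843303757175452967947547946 ∷
    14455812141316996139714599798766959114147338324280745 ∷
    1619831525071498319213056300699864 ∷
    433721254005231907044538453852887 ∷
    538310411795557003690523832906816012302963442533 ∷
    14342119219294245369609494895904256764653088714523881 ∷
    4779671435544964718770587766140016253202334435 ∷ []) ∷
   (1839707821455483503374570034943103472193983785342966187 ∷
    46634908942433472711747575063324121 ∷
    137201468838796744868114670787200529299844834040821162 ∷
    5775660060490117329315993149110371851719182839973609 ∷
    6657353831590908487325733412163672 ∷
    137838064981237474735497916917571192553918019374495018 ∷
    339065177718080151984263197885143 ∷
    669565100009189098853981064474563107806640604773 ∷
    13888542436745911764565087431282785703435578390611561 ∷
    522453507882738757107239636767006262073124716581 ∷
    14382466703243464650005545227485002424808341862876329 ∷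
    1281317535826437376158231425491641827933 ∷
    3800884032766955477172789309570418303477744931 ∷
    231701493768687872145688763739142631720095 ∷
    3843787816637727571540016625518378087316719523 ∷ []) ∷
   (171046581199151419272372434532610300518385918821872810 ∷
    5482565436954454287021034841330904 ∷
    127354499164452112265864806747862599835736317150442922 ∷
    669491690776675110044564877051996672175164097445 ∷
    13882558706995380994985738571745774657495558239552745 ∷
    14453267177804144567123275506935880170213653304051945 ∷
    14726486357464523890453663960 ∷
    559785634607398148861146318248686938 ∷
    31041498472183383697129686083830745 ∷
    232138710405139386885778496553943 ∷
    697204185674709779763760119541653249161459926885 ∷
    99627406693844153909659652861958571624694237890089 ∷
    1609096440187936977173569008173332825821 ∷
    4430825980024254913568033186107879198373708451 ∷
    231709857279959526757334534603834004604127 ∷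
    4431020554912161408054266033056741346712225571 ∷ []) ∷
   (127409425729932334850847165239457114512480027292022186 ∷
    6559663942949990462390793710620888 ∷
    137091751180084054883689069731112898276015583996753194 ∷
    552707903747345881300121022744998852509973349221 ∷
    13230883157290550591179474652848562296552291391244201 ∷
    5380483735021947880279302343775000 ∷
    4513480060573051260187324430202724443 ∷
    33674209795539404241023936286162969 ∷
    648676349936098177488632114323848029227342890853 ∷
    3507016369745139484004931689851633252252496709814441 ∷
    185367878010911808794160465349436252358303 ∷
    4804736124320648833555831326309558319872738083 ∷ []) ∷
   (1967752401088049516866570893500213512176578293249447403 ∷
    2925965767645778450495825342648536 ∷
    171046579437457874840740212442289401061739184387076650 ∷
    543896129724885744879178782385594059128756765029 ∷
    14290407829485544701549433131911271022342878093117993 ∷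
    1618596900723333812489355618439256 ∷
    127373875966100419415507303818945709148 ∷
    59699322741428828912301967562507609 ∷
    637780435180144807562294692981810387468737315877 ∷
    14339091462296146017349157682007345310982123774804969 ∷
    231703229403492656525450011600969248278175 ∷
    3630245069138993874493890289333685472479674723 ∷ []) ∷
   (1967971742657190265961861798301761739123934945721816427 ∷
    2614230233647400686679552021254360 ∷
    137835031491011333915221383805442346240852686129935658 ∷
    3834909685533861113413573004210553596838172679734313 ∷
    5380495914309060632792034277610392 ∷
    649926695903273737089889814371529674845 ∷
    658921780817997693995140640235181731859878381157 ∷
    8811421871463464526259092504876527810597543009323049 ∷
    3629179282582505669654715540720697431803560291 ∷ []) ∷ []) ∷
  ((1967971610672421734325109616607984100565522422241522923 ∷
    31378997411440939005631301786292313 ∷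
    2068443416452279660203870307664073553601738561278547307 ∷
    14342140515444025547125706241659786456573494093940457 ∷
    47562635284813780610476859558482009 ∷
    207223939559489679897229229031511 ∷
    14342129643699389291240315259564509907918722371946153 ∷
    690120191016620388540579291301666331883214996645 ∷
    3843788927044487026069285560448910768480452899 ∷ []) ∷
   (2068447963228928171844141226991459325524344463543866731 ∷
    65759725946660737418272066295321369 ∷
    1528253989974958059155971625029599403706360154216801515 ∷
    13888542438980762968774051381796005470428039952991657 ∷
    8154798045228674017919986357334627681958407213681193 ∷
    2055153219412752208137316943098958928828019132368421611 ∷
    15520022689287354084983408471389465 ∷
    559618907309201672541012295582037274 ∷
    28662937320704822174263549500850201 ∷
    297899822430455812947743476547607 ∷
    13231728196679184488650115024673892043340303829305641 ∷
    553493296868010631673287164710826793533723115621 ∷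
    512184664206224668787237086517948264202131997541 ∷
    1609096440187936977194890660893067051613 ∷
    2583657928573629390206031593458325210190054371 ∷
    185367854316976812849468363683574010872927 ∷
    3843775016926831451225099123139482673479681955 ∷ []) ∷
   (1967971742657190265961861927504701167731591774722692459 ∷
    73531363189970192937667579577913433 ∷
    2052558953248467877302049011068829068870487442583295211 ∷
    10835107276001888264771204375850450741332730355384873 ∷
    890232103884755765544511801821392895565237077507047467 ∷
    17214326464966031198420795150553 ∷
    6878065301191595535719922306915262491 ∷
    59494428449307273212693760958529945 ∷
    13445725442713706369985989985185195858336280976558249 ∷
    553505606405712705465759842711165005361479418277 ∷
    512035984851974683877192190255556352775838238949 ∷
    231633902302824745715970651569301261123679 ∷
    3843775016253895597199875128905143525247551267 ∷ []) ∷
   (1999093039611010139473642320178001103940918999396488427 ∷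
    65759731941846040851173228364977305 ∷
    1936619788789259990139117629310256460524332859953878251 ∷
    14346611631869700552472147290513110783687106863302825 ∷
    1244595560353201820658310777429883642243633501822780587 ∷
    48788340474289468123537845014745 ∷
    80608958309651210704162061859702261340 ∷
    33519303310372314655400519815922713 ∷
    14346832605378516032447071330241688323082240829163049 ∷
    691655126086169844525376250081724432357257118501 ∷
    691506303926127176566624002265591040419316106341 ∷
    185363812691019619461995444185134899658911 ∷
    3628149460861651752789618634784409207609231139 ∷ []) ∷
   (1839708198410991425584938370957844454336779443801791083 ∷
    78666569732168125483153160765984857 ∷
    2071078200835765194763145622545917909894324330091615467 ∷
    3143868643166763144826690073700004143868811927094697 ∷
    64565459403283715531682927423542617 ∷
    1529227977674244895218240815003965083741 ∷
    14342129643699389291240315190366601689488120725898921 ∷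
    691727041384912882201473913401940194013585866917 ∷
    3843785762115363404016326617854269971259983715 ∷ []) ∷
   (1999310686317038773769133007402802594986553939204085099 ∷
    35012800404228756935488725429014617 ∷
    1904403697101382128358418166324352028274917978122589675 ∷
    6163319632911820516672004632640365678515007145116713 ∷
    65759639757233365925576042774549273 ∷
    134991615930855709428409958138327 ∷
    3379663797762193178320934422890481787290289488791145 ∷
    659209339205216027970222528179865172285086236837 ∷
    4803670359899037291363497349023893074732908899 ∷ []) ∷ []) ∷
  ((23615660913632057370609937749946875243742781931179320876 ∷
    376547953652625808665255178712670490 ∷
    23612989499627285824377363978266476786264595156891182380 ∷
    14310312962925698843169664982780563173073769429993385 ∷
    2060210127665985234239038948518525393528320878705378603 ∷
    858797663238315634969554384891437082 ∷
    59691781115820918930604672124453081 ∷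
    306320871635361657067689037530199 ∷
    11278230145458073527699273475867237877316089640911337 ∷
    1591600929650342004837132746214510610658271249197433771 ∷
    691514856128436054655539888214207776436351140581 ∷
    4804736149380654856994282142459423450411828003 ∷ []) ∷
   (237647451938330801899603762661490074408614185216802113069 ∷
    4517389843734646547352211359217246491 ∷
    297855851718607214424906241280915603201757046365965878701 ∷
    8266001003167817304415400392425039451 ∷
    1302934005341716236664253537736630987367398654274701931 ∷
    22013866034739163569700771373614589783231645565230098540 ∷
    48824933289656203923301396803485785 ∷
    14346470851429990354158824620180481404026149515560297 ∷
    2081265925749356340443353277829652316344690791745848683 ∷
    2265636825937111501725253525533041394901850935002985 ∷
    1646416143860073105660352265146001851141536899366389099 ∷
    691734135938050428076234710516175955957211201637 ∷
    691882016445071868358941561877948651221911864997 ∷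
    175069692711672737163019288504331474567263 ∷
    4431034518966914735835549144629643050940893091 ∷ []) ∷
   (2777937276491495549502603011784292805279012861845687334574 ∷
    80585126434744631183035964771464725980 ∷
    21982284633602137603041907630871399008127487593684249004 ∷
    186240272271737611064837248870015258 ∷
    2065268234230058325193459574674833407672134386466949739 ∷
    22045336688465997002348722834130438783846306388768827308 ∷
    47893292065613780139830183586956249 ∷
    14346469970561184338148019095935576823467123809190953 ∷
    2060685064899556959525581961670871336780085437416604971 ∷
    99627406693844153909659652917974413118534644925865 ∷
    1936182955624929173687473061249466207558262878984997099 ∷
    533324085532202747637378163868489178358531229413 ∷
    512183847620751410730962045401744026677591147621 ∷
    231709887412276293860397508848961632339423 ∷
    3630237746220977572282005818612882549338276387 ∷ []) ∷
   (27117580356713143456788734277093542961875111539933189591407 ∷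
    1408089689549774500633569096677541040605 ∷
    24852902420766538353011458868196932220276278823000057132 ∷
    958751121898079294651743998417854618 ∷
    24852902463352038771803346878062826585734120402855241132 ∷
    13888562031941938951672348089273395588392025964938281 ∷
    2057815696272995130673985314497890428661373097405581291 ∷
    14346346581232111198057904419165336947881896029455465 ∷
    1842131574635868775864408649410311028384602434598340395 ∷
    691882016455199829501704957856298277701234460325 ∷
    4802640538178183374498400443087604850538579747 ∷ []) ∷
   (23615660913632057368529265237768809734179757568698721708 ∷
    376547953319242679587297346907037850 ∷
    22076057037689751785449152037647245568557573209630812716 ∷
    14346344868829448932685334251503372066305197043614761 ∷
    2060447620753815825291010434385240779574366670785610795 ∷
    944591842420790914022187204715503642 ∷
    145791521081744524028113162287459782705823 ∷
    201666132258006869098262626566999 ∷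
    13663424437235458124265500498658243828282748602943081 ∷
    1936773705082692716419085555118992211448065857929611499 ∷
    648639390379621372846148640686307666169442600613 ∷
    4431032448000199840758597396273343013729600931 ∷ []) ∷
   (24852920632882914117159674841345055492449160196955153836 ∷
    376449154102819256991104497898512666 ∷
    22852892029611496876972680831725642136279967098064708908 ∷
    9048154557854660400566450815897665590707667389384809 ∷
    1652683947324777988424975425896223036284839940978377771 ∷
    748196634105979294548074813293355162 ∷
    139290231333271541768611677369323279435359 ∷
    569097874976335312692995365273687 ∷
    13224411924697965963674696071680769327873255372753449 ∷
    1904839060300442357472828437164350451850476406904194347 ∷
    553505613116985786416011522263532196580175118501 ∷
    3843490761101701346495848579635746771373656163 ∷ []) ∷ []) ∷
  ((296320880207934391557463239619222638272560330641481761965 ∷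
    6878064719870576130374818918724034587 ∷
    274233476385246161410635698964169699399690647606468904365 ∷
    895038897638313499483708868201555144070430908815769771 ∷
    8791007269986124668143135972039352603 ∷
    6843925156944470852471281261216793 ∷
    10612896483452005943926400286026903066717741683311401 ∷
    1967914605396619637517247027938439962692278583768646955 ∷
    553505609945370506780381691368154619233334987045 ∷ []) ∷
   (2751745964669301793499259981081308047063785437912664209198 ∷
    59809966512188265113584422599160583836 ∷
    278810344098563733238992187110377972755615595319377102253 ∷
    584538599519647147053986519803355 ∷
    2065268234230058325193459574674833829200449975817603691 ∷
    287900738830535967402952503117755634582465950717319939245 ∷
    46748067756667056764712030067492121 ∷
    14342140515444599027312427191310103042074359216473321 ∷
    1297673973952198813660463346161701843252837533998647019 ∷
    13450144703452052721866592223748736536766158540638569 ∷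
    1667675839809802735050339005124878883248675851229201579 ∷
    691880440828321293363389682877154422307503997477 ∷
    180898194100346550426425413761489602226564368485 ∷
    185367909930008147360977704952490140632671 ∷
    3841778156428843351941480239216396370790318179 ∷ []) ∷
   (34221233298179402961633424225194059562773408069484985800239 ∷
    1408089689559738460237755313945230726365 ∷
    263787415980512978451031827573383696123400329110997272365 ∷
    10472413816301820002749408745383355867 ∷
    295567526672761625784762931508572598838157127814073648301 ∷
    13882579701024300189352369310415381249028005350344233 ∷
    2065891677600621864961864366577935778334941881211553515 ∷
    14342129643405174472434170089999597733509622386132137 ∷
    2065885958042500181282558569693304264524864645280827627 ∷
    691880982450180748852405662072132960045781484645 ∷
    4804728823537509193990787626916078192267624995 ∷ []) ∷
   (297856290095376239633041207343487387897689913687766828205 ∷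
    10304108320484918018559334859141832731 ∷
    298234829049198418848102950285335832730068515485571974573 ∷
    14310301310656556759772432738216555977197735745684585 ∷
    2081673483628947039643815591090014162527433275942373163 ∷
    2235078338528061642774431240945493467 ∷
    93672600434754983290537876193816040202271 ∷
    432568295583935523151242898178391 ∷
    13445714897229907633903382717268338905384888007657833 ∷
    2065047480625376292609513462245347701962222731982014251 ∷
    553505606405366653124131457822131161262763018341 ∷
    3843580441351490900911970386569112398887650979 ∷ []) ∷
   (264917908152363611165540530026742620166344552952715905581 ∷
    358580445537357923630323936168534299 ∷
    295568185003608917346720746145358659207731021934074889389 ∷
    14346469970561184373639541798876792953854067994265065 ∷
    1999960005091191727071445524298738760961658471536396075 ∷
    8266028862567515778133648204190474523 ∷
    220208416116109269091759013095776714514463 ∷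
    332543928084388445291767249240535 ∷
    14346346580227132654788454190186835569328046424721769 ∷
    1936754494041357493402463613432221854412644667815102443 ∷
    553505613116982311487737314213748819092165363365 ∷
    4804736146441586385592269015842019736333320547 ∷ []) ∷
   (287900738829653583422755153066036641104956133721470764461 ∷
    9778400621959175216594929780309910491 ∷
    298235047470992439715165711176887768940890497939063539117 ∷
    14346469970561184373639541798876792972998094442202153 ∷
    1642236491626296431744578950464857123663911619601891371 ∷
    4518560705047291922289765356046934299 ∷
    73918186848608859240089286963626201 ∷
    209893236829428468637119914180631 ∷
    13230995612517863717107682223652373150776597359101353 ∷
    1642340858530740898509901738782882358572956418495480619 ∷
    543520435288324315329380213783059003320299422949 ∷
    3835169372452930700521267882942194333851320547 ∷ []) ∷ []) ∷
  ((3678151384805903125952250031524068089990022371 ∷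
    2838192064602559554721362395310866865996114914312642962798 ∷
    104666890383902000114692835049810785948 ∷
    130198279057420873752512522823879877985823 ∷
    2805591816187381320212871789501764013111102594075058054510 ∷
    1150618218808293906819289407390214586256695577503859499 ∷
    10840612264089182776705679147059074291235439886730089 ∷
    1999310706464620082494605921875279316622043724345508779 ∷
    691882005513701015346937830511592684098458485285 ∷ []) ∷
   (306512944184148298754518326337004927769449634 ∷
    42616296466070486090281743347140452383036843297498799388143 ∷
    3800869600295963033692403495672784590097155299 ∷
    1508026408121478473729625941903246984541 ∷
    34221233407773515377644072149282771125704323245992353023471 ∷
    2858210778491887808033842584318733844708360767052741420526 ∷
    13670115494127476361524262497925971551779984055732265 ∷
    2065489917090775836075499055091966136180201131166665195 ∷
    13231728196679184836711258627365807000735273435006953 ∷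
    453369582098180723492879040896791665570569609674228907 ∷
    691881799039808936968973514294463022671973057701 ∷
    3843788980308648924981158240478045334702916003 ∷ []) ∷
   (306512615400484847729588607579090955173172514 ∷
    3400265173040936808764606403763564513793267033575972250926 ∷
    145536784630745690907966442282225023583007 ∷
    1559374570782633050319825307776276497565 ∷
    116957797949779818259641585487844495708 ∷
    2805591816187381323797953275059320749440388491331030295918 ∷
    14290407633729208143021060271427357118817797800724393 ∷
    550914899238232516627095076735420450556605645968114475 ∷
    13882558557576458127389658127600799993983012186096617 ∷
    1529482231679769827873009313300895959152957558136242923 ∷
    648639390354870719192167219931830701397936965221 ∷
    3843788980252838613017641736078610965664368163 ∷ []) ∷
   (251946607142231842053948612150464765348089954 ∷
    3597100581369801598211876600641373309847240578065759315246 ∷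
    177691895164032694480220316659578098418463 ∷
    988150141810571210823269559092198245533 ∷
    125669822477225843067156533917693081244 ∷
    2838186839644324977799596535917916081461606790228428793198 ∷
    14456065859542897650060905055486783870459680971818089 ∷
    2057818709827425963444831329663081193323891994961643115 ∷
    14346346581232110481998227312676998986640567098410089 ∷
    1936189964163730717494241809677424885102598849194362283 ∷
    691879407466588400508661689569781685584767486245 ∷
    3630234206213485078361374375444400365853737635 ∷ []) ∷
   (298430873934797661350836762933268095931323554 ∷
    3455826993207641859301178202083282678069591964743009678830 ∷
    531571254182702560264059399535949468 ∷
    142289724867418454500505741841639943963807 ∷
    904156997462599743513879067040662160797 ∷
    3555850433884781640206471478401292643316923153636338508014 ∷
    14346600205304302289005217189417549184106447970763753 ∷
    2057815696291347706439088377119660319618288799422612779 ∷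
    14272147231096508854543199288698789286732699744863209 ∷
    1936826472579699375327502637972739377904527684248798507 ∷
    512182279616614858872085468144221094248961802277 ∷
    4804736173984119325206877016841539493468045411 ∷ []) ∷
   (215296544458524735194122816999497328737457442 ∷
    3574278080929175780637605363019268599377859461881213335150 ∷
    123613210108147079868018829879302780572 ∷
    224549938192690840526491132221427430197087 ∷
    2858210778618878834193546539307190063331488988376770618734 ∷
    2065268234230058276339508543801794148849663476243629035 ∷
    13670094408682303145982794669670953660552168553056169 ∷
    1302934068752081205296897059638924304446770404712514859 ∷
    543895074848188245355746236084982298576617997541 ∷ []) ∷ []) ∷
  ((2078470114932019484561520346060783221136258659 ∷
    34058242075729234483243270863417341222411761626611905283567 ∷
    1265875630137122546935434124235526918365 ∷
    34221233298307858792930174533549454818304311810561566655855 ∷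
    1273997227734154777065645947777621854412055363890185003 ∷
    11477377080908430979730796031895840413910599173408425 ∷ []) ∷
   (301302285795507301674933155101927326376837986 ∷
    31689874736120948846664786317149469246691881976933842781807 ∷
    142289724867242118326601994006681173362527 ∷
    988137315827958094195890092609379500957 ∷
    1338836528603062578007038091370530362397 ∷
    42616296483994329219128214065296369435847619149604795532335 ∷
    1999952680749878099262662951035321624952797785404475371 ∷
    1667896560743644395665557440664765678897196443766359659 ∷
    11477377080908430979730796031895840413911245565986153 ∷
    691879407466231446435899105490270761223018512677 ∷
    11477461644251615969084931979761976639567994319538089 ∷
    3841778253396769272064537223162415772424208483 ∷ []) ∷
   (251925366044909946015442850667480770716942754 ∷
    32348944133210921707112596372351864612142411386796646942191 ∷
    110607530067549057080615993024559244116831 ∷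
    1559363605359454433849840412603089684189 ∷
    1215059885096793220411792984243065606365 ∷
    34112845592897870803888017955969035281557899447136380339567 ∷
    2065265189949185920568216244907102395216351434049061675 ∷
    1273997227734154818038987966259257725770126525145810539 ∷
    14346346581232135763430055724122374859590044529721961 ∷
    553500052127147546224535553676312281871999305765 ∷
    11424313272764968058315169847278269920243903723733609 ∷
    4804736225382146774351040944572150644882801443 ∷ []) ∷
   (251893229529902147546890094789752526614086114 ∷
    42561723840877674105798065830711651686849825964961934165039 ∷
    1632236517661287543665686513989027385437 ∷
    142289724867418454533773363737825715422495 ∷
    1559584313925864022014342468648758674909 ∷
    34112846192736474116146785856037820879183279028773314708847 ∷
    2065891931145837562388675606277124100729122967402841067 ∷
    1650376839602817220262170180155797004372860953747259947 ∷
    14290406679456127154947507019994370832012548302177129 ∷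
    637922159346570957941375745534123412516851679781 ∷
    14253866565043926522815260662612367418752799185305897 ∷
    4804736219053718706060540296217442665193537635 ∷ []) ∷
   (3764166751761146583021042538779135482056459171 ∷
    34298521385029848915456787159065180904393288540937550906863 ∷
    1483271108499680793780489568544131141853 ∷
    224548583132238918706995788067080263698271 ∷
    34112846165348306698064109852810752447662989899499405919599 ∷
    1999952680749878099262662950249098527947828850435556331 ∷
    172157639800051822080155363881536389289800040272628267 ∷
    553438873315027019292993705259192634672657991589 ∷
    11477491593773809430056632994269750592932018219123113 ∷ []) ∷
   (4569045418980229801764314934928234904254248163 ∷
    32348944134781568098054190513780271584393369529622227928559 ∷
    1215172332928164224945796952853780385885 ∷
    142296564279571156638571154004215460267871 ∷
    34058304773955160374614117471028470651431090015717858559343 ∷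
    1274000249932292646633340638449391394765911909850940203 ∷
    1638949677778509652088643116744600607040798071349315179 ∷
    691863108928730998638589309157216410715392311333 ∷
    11440718865229545506335935374142747075070259881839081 ∷ []) ∷ []) ∷
  ((301302285480054091639158547012593888759432034 ∷
    15223130103272559500129541491949540811998 ∷
    124912490928329692604684807288045551747935 ∷
    988163473279065892197332627571717702557 ∷
    1999952553904838209064784051816695922934662478647264043 ∷
    38147051965096269512968059193701910910401770849187710108911 ∷
    8847233580681437665918883653216338687101027198435561 ∷ []) ∷
   (306841890452660166169597632195956100456301410 ∷
    6136746691114150212843994966875528906824407945379606181295473 ∷
    175019954319959725348637489196651213488991 ∷
    1604799832983717194551835538176166855581 ∷
    14283654598063364449383225793407241183262 ∷
    510740686524374659879421810157158823894250591206384329393584 ∷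
    1999952680749878099262662951035321624984870367788008235 ∷
    295568185639712188766569262440595567103403377832201554031 ∷
    1936292570708424203050396263794685022444066089285978475 ∷
    32369892176054698562237148306063447183949818602561564836847 ∷
    11477250234296554128348295063817452805164183792388649 ∷
    691882016455199853685987170640530135785102378405 ∷
    13449657878786446515488391460132643859935647422744617 ∷
    3843788980308648943774191962847820372997309219 ∷ []) ∷
   (251893229517865593807660987444415754309779938 ∷
    408698903943121836129301721663866480425864262987522841339376 ∷
    84503842625122471012058962736027294 ∷
    142289724867418454534036448950303424251807 ∷
    904156913875420997517320677452556535197 ∷
    511396317311752374917353963528718707395717282757309146957104 ∷
    1999952553904845340446839203576512932310148253727327723 ∷
    39507538444897130162030106593855061463298392978440467778031 ∷
    1654073992804082531008221311975647474331214854702499435 ∷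
    8796395224293609756459436132949198567752860795631086601391 ∷
    14346865474314336013017792317958038252210864187770537 ∷
    533025425003736122304111709663550588357879792485 ∷
    10620665686367354005340176523719764823067534905313705 ∷
    4804736225028854986338975869918657746447632355 ∷ []) ∷
   (3615627450366607615997729117868556481177633763 ∷
    409353775445994411038091388018942325986683605923040653829616 ∷
    18096317014796150668376932430742864631582 ∷
    224549938192699184748121698169737379841951 ∷
    455824639035847153084484579155115556889571406109825599113456 ∷
    1999952807369609246358697949865888708499133927946978411 ∷
    1533055700496247159166722312230132516061 ∷
    1645107248488994183049933850846917919230904394081371755 ∷
    31689990676057559125330030476228738341891404996912372252911 ∷
    374769425580092767750599247449491442137129026149 ∷
    13445758329962822430059460746291229816681539804595625 ∷ []) ∷
   (4569045418980229801764314934928239045676463331 ∷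
    455824654600877068973664225338710279606214321049453328172592 ∷
    18097341361344597626213482287570144040478 ∷
    142289724867418454534039162382414788428959 ∷
    512033401440575114036328392498043049728249437394327275668912 ∷
    1999952932599717953827674961640308235251431971490890987 ∷
    988150141810563419485105774870693676637 ∷
    1576262278477969310369741372279897548194517301250753579 ∷
    42561723874497623940033840755039532463080915505377513047407 ∷
    512031395548518628682476870450204445319813399909 ∷
    11477489819261560141885362760330565976193141496089065 ∷ []) ∷
   (4569123299276396480926812816031186005890004195 ∷
    510741823686236208988624715979894532469176314935174920766768 ∷
    18096345456614526478721734551070911860958 ∷
    457132098941793374805509633541241170843831638169034899162992 ∷
    1533069927188348172886477985837596279965 ∷
    1652741652212604150317572519206718518973329180887352107 ∷
    40675624928090153459044458589583444482563138015523053241903 ∷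
    13888309155435726578576777924676912114955397520949609 ∷ []) ∷ []) ∷
  ((306841890452660166169597632195952960835208034 ∷
    213591034678219517383775932844355375674143 ∷
    177691895164032666486798801344021623472927 ∷
    1604800015582459407254198175255252436381 ∷
    38198471913488709366188575291363081469885019930374803818991 ∷
    13888562044732817796935761931427038148210033791336681 ∷
    58628207475613420120133684409926745 ∷ []) ∷
   (313676184250959209718500595284635108661052386 ∷
    4563342057479281784886783059505648015125581089020531543738097 ∷
    217155802256129863433329261382860615292575 ∷
    142293806896173416689934133722998564718303 ∷
    904156913875085079392864632495368308125 ∷
    4754962517431473583943055040643633003586212483215958654420721 ∷
    40796871852961438974595557077507270328605544511546427706159 ∷
    40160939540046888205231218041769758984460987221717104723055 ∷
    11442567727693700704450005475193785554712181547730537 ∷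
    648639390426758592737515992826506833272594498341 ∷
    61692943041295230570674502733136857 ∷
    14339116414624285543997534723215175514643942462195113 ∷
    1529375861577499670732394836697740260088803169717454507 ∷
    3630245148065615152642262182413411278349404131 ∷ []) ∷
   (4650770101000516107079789615018014551919084067 ∷
    4912245305351932937074329607047249854425213409992788476790513 ∷
    46348711291689077308122453978411704358559 ∷
    224549938192522831997788061699684129310495 ∷
    6152463483143477462345059695058934741238394395753207970497009 ∷
    988123271739069010779417396789635974621 ∷
    42825325827832885394603425817764726297682617909092622009519 ∷
    691882016445071868358840467859687036184862654821 ∷
    58394403109644020062135513962775641 ∷
    11477450086391546236984359049205889114663059453902953 ∷
    1560938444188344205505028545730369201827587223122347435 ∷ []) ∷
   (4569045418983057129509376674062423544004441315 ∷
    4912249851754050521691494597927227659749248280833019818116849 ∷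
    51191966253493977682734720548823038189727 ∷
    142296564279571154305806400837807821554783 ∷
    4927857579174779550231583933846483460073618631842307329328753 ∷
    1510234807111181608438436743927745742301 ∷
    39506310209884215068769754596233412247149874867386428949551 ∷
    553505612896262707841470425064616100312060528677 ∷
    77282188915717211738294930106221017 ∷
    11476984945091103522352926976993775579045512454603625 ∷
    61692840613689313493321464005263961 ∷ []) ∷
   (2078473654947831071692674084541608706685105763 ∷
    4912245305351932937074330123615175432803062039856567693969137 ∷
    234978608197819782505526654941802278969503 ∷
    4927857594956331666181945132831117495502064857499668294502001 ∷
    988137498426700306898247263036910863453 ∷
    42616291274077377835536187401884870129768929584580923492655 ∷
    11442621167233035568550792430629462180649225274001833 ∷
    57441369616926290201938219551949401 ∷ []) ∷
   (301302285795507301674933155113772936373519202 ∷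
    217155802176683698525974697147934242296543 ∷
    142289751155185957511844536203489570194719 ∷
    1533069927189081993329160641537083704733 ∷
    42616296078061155921473771056645335590066709402601140520111 ∷
    14346469983352063183411432938089219383285131635589353 ∷
    61791743768579907653158368857556057 ∷ []) ∷ []) ∷
  ((3672033875167983196667779147130221736481047523 ∷
    2605873716145269873491260407215790313517472 ∷
    220764076637956379535984873029199646426847 ∷
    1559899768403635497982676067792297395677 ∷
    42670944767078467205717720693893287431672380989613543524847 ∷
    4846753924878487616205062287723971228449510983600964428628977 ∷
    8847224111340622937859720288397102899817410457502889 ∷
    62063443809832840204007510852501785 ∷ []) ∷
   (4650770106844501782417223425218074789588550371 ∷
    883691523520437630649191626485787089996018335217471818396169459 ∷
    142293806889196442501846086287131699316063 ∷
    30757109706039858357418416838142666029162785 ∷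
    2605869626317453386533493918780672977219872 ∷
    1533055700501450697210325308638254597597 ∷
    217156474016003202150063319038951704495007 ∷
    42839699069667468390497312603043789397711082974898886542447 ∷
    4934951423680677718812072365463408824506545176388034404025777 ∷
    691882016455556809879185759027578410024285766949 ∷
    61386398953585613425982333987587225 ∷
    13230967279959676780498304324014560180403592472035561 ∷
    516486661906163011049887605896475018291381201927145131 ∷ []) ∷
   (4569053861338466639978368859296551532877149411 ∷
    73640987563891753206005369973263068155085035737099942449214002 ∷
    224549964480466687695808475938524642149919 ∷
    2056846262383908109354420858392332795492128 ∷
    4502942713937527178780547494527273535189644515 ∷
    904156913874299046171715434288759440797 ∷
    231086578825426483042351499262065297065439 ∷
    41471016157749872113114104780354221774554864191894544450735 ∷
    4912245305358167694882838310315540978093820788399828167557489 ∷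
    659209810122931030548077364772146077134554663141 ∷
    61995698753477124127757787201536409 ∷
    11473064196187129243684653600796157166312389320114473 ∷
    57442055695173140827254387153829913 ∷ []) ∷
   (2078473654945416261371238186928697268098397667 ∷
    58947052714729532905256858780811145206472012403697050782365362 ∷
    2187432553819166606791987308343581089052448 ∷
    3556067304577636491432473600796777988129080291 ∷
    1604771274285415627293168954695473956253 ∷
    178190915270003207035654440589565625893215 ∷
    42841769960045933462134856906002869808879196623894615164271 ∷
    4904386858922222813260791827705143687298353638432976399762161 ∷
    11058407552142103449704684577611604606741419036510249 ∷
    57311586517104161683024098248098649 ∷ []) ∷
   (1262184629109152496405756323883521398056468899 ∷
    2099623472106354304192932461088328258742048 ∷
    220760020896968920357895275509690651903263 ∷
    1604800015582459407254192708603698218077 ∷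
    39506384004395903939461139466950874443587457205170012686831 ∷
    4904294855337002728620609217888711818598427903572289118536497 ∷
    11477488951172607636329425055868706058336303937749225 ∷
    17725761063483888599520195077210969 ∷ []) ∷
   (3628152924222541686497927205459441754598589347 ∷
    2188588679626135105655038892061060059182368 ∷
    231091202243768509999515834154249237300511 ∷
    1510234985148806089873505446485774304413 ∷
    43165964271620520199786373294928368050886621633274580044271 ∷
    6136762071994550517478642020929173249522604032116900777953009 ∷
    11471541982346101237672000546906029364854705541351849 ∷
    71556172534923498622504172206949657 ∷ []) ∷ []) ∷
  ((4502949856450613115378187620083736304494933219 ∷
    31780197266565110823275479247956934895133217 ∷
    220764076630979405347896825593332781024607 ∷
    26204681811349840680485920246711976195892892113692335802095 ∷
    217156499265334721924323396837970105861855 ∷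
    72823320064362025955852719610660377 ∷ []) ∷
   (4569053861338466639978368859296555674299364579 ∷
    9991442564603163463351981702279427046912348542136547300766787508 ∷
    220764076637956382470224481460478325294047 ∷
    33837068546510855325653966083593182592131105 ∷
    4178191264761861819553479513845051462337001251 ∷
    40803245810069494746616530553372293180471249453203937297839 ∷
    220760022986797208271813928469482668819487 ∷
    43164828418600439872333763364421793862178886154290878219375 ∷
    5689085555358492883209244361207111770758423835871025270360497 ∷
    512184881626127471757911480016371491111258032165 ∷
    59782348024048136739017256320632345 ∷
    14255483253996035695060766582572473191677815861282857 ∷
    19397109154085895530252928246874329 ∷ []) ∷
   (4651046260889645221920076863470121194804049123 ∷
    818860439080694676590268605966656098505892645070845369949980083 ∷
    30757108995627926687612997410732982283821089 ∷
    4502942713935435534420814805855334249355900259 ∷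
    34058242031802120888338205086772887844851472571357374448239 ∷
    174448733769620903206234359850851806740959 ∷
    42837961347012934553959588388851396331483213688153208523695 ∷
    408700822206094247986172629605893753875359245052739988226161 ∷
    14346865493091039932984588131529152545849186696824873 ∷
    19397109154085657298559215029191321 ∷ []) ∷
   (4502942776249248346791110312643526992807425251 ∷
    17898722203423545812821293575798529556817377 ∷
    142291799756812221027988533624465429890783 ∷
    2601496246220310632676856474286089959488619363 ∷
    42816719382149353763710943287255176961758707814112096684975 ∷
    42616359776232154222767212670879598632389631178760398046575 ∷
    458381284418168949252223740457023326354329192251987974424497 ∷
    11477488951183645919442093811350446824680238935442409 ∷
    61001280627214453605319116324865305 ∷ []) ∷
   (4178701101022696085897854886021982063468050147 ∷
    31270532244044476662253685876983651278840481 ∷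
    142295540144868648561543985075552999966047 ∷
    3702075040713152724295954529976074319067349859 ∷
    34267410757245715526614750188598541901805415121487409449903 ∷
    40816526261759206772601671691825822623286441688402428430447 ∷
    5971614600523411231545168461097668791212062712627309695208113 ∷
    13669374482570904150612405767775002833123939115336809 ∷
    62045720071665846254837964140971289 ∷ []) ∷
   (4428910339081267433335546568185294728200811875 ∷
    30757109481814634180042483933028799863644705 ∷
    231087063505166026843856769081322214262111 ∷
    2590242078613207891628862088373019484000616483 ∷
    42670928985780400709034070828551717203567962206203275119471 ∷
    42561723877362489067229263374542484375761489291536599353455 ∷
    6215789912282893382171293887837746352759569594119945872475953 ∷
    14346453246854287903394682238022027686470730928621161 ∷
    61692947814090708463028998464603417 ∷ []) ∷ []) ∷
  ((4569053861338466639978369176400177540153046243 ∷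
    4178701051098772784412626911171425255023015459 ∷
    224641607045733097793242061377289133229343 ∷
    40798753363402432681280154298611456634464733756599918659631 ∷
    231087063496994178274553278292141786268959 ∷
    62075969844342824415919119035007897 ∷ []) ∷
   (4651049927599238687276399650596237707546555619 ∷
    127251579386943018813483594213431014701917615089461932474894264117 ∷
    375245226161210169323152763120946691900561314 ∷
    4178701051098772899202452275824952740237899491 ∷
    42616359776233054153770369292610633891788530767102845387951 ∷
    175069345223310018953405009078818008727647 ∷
    42839699075555852813522029398838476155150684616447016305775 ∷
    6128888233013586004072528319656262646051908278820126072506289 ∷
    14346822250596393434993012193121048116768534496807273 ∷
    61693114136357679925988463912943641 ∷ []) ∷
   (4429023694501426829967765601060800736923317603 ∷
    375245226161407759808726942890480713076908642 ∷
    220762069498595183874039272930666511599327 ∷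
    3683212723320322792426621766773011111190462947 ∷
    42838718008720289999461431924174167468187238270995343083183 ∷
    34297399883122733356081343100247662767267078588117221900719 ∷
    4904386847195691682105573547969144197094256707482543222948401 ∷
    11477492393094997528286404002947640812570097274061801 ∷
    62072477099975944648716416976945177 ∷ []) ∷
   (4429023368055885690661832272032119566038037731 ∷
    296185861787950180349114306887153531666638498 ∷
    231660019878090215990176154861539121694431 ∷
    3859505769828169355576607604520786124687802851 ∷
    42670928985780400709034070827179205373339712148240689268399 ∷
    42561862454591263197734807349287959877308022868792439735855 ∷
    4934898439785490622902032473475435318148565240096748920635953 ∷
    11477456359056174429033114140002122543192451194028969 ∷
    77194976755624589150783616558564889 ∷ []) ∷
   (4569053861338466639878301172347836872413246819 ∷
    302345947495786420548445071220433325064791522 ∷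
    224545825468984159890973297801166130251231 ∷
    3816728854665106798673709757981304517372149795 ∷
    42839699733121261040498137973115704526196378243615189632495 ∷
    42670929508271891846291079092427403312301659529236434651247 ∷
    6136746693742815396339662347319025450832198762895102610770609 ∷
    13669374622500605184360631464268745401935844190717225 ∷
    77293791496294515513791220843283737 ∷ []) ∷
   (4502949856798345802108062694707652526382609763 ∷
    296186748811255613494336202520210613148394722 ∷
    142293806894718081739963719219897488115103 ∷
    40798753358828032625386551240876343106891132504576425461231 ∷
    220762069498595111990906818442157207586015 ∷
    61989499864718844779426834227921305 ∷ []) ∷ []) ∷
  []

-- Evaluation of the two checks, and the theorem.

table : List (List (List Certificate))
table = map (map (map decode)) codes

-- Proof by reflection: supplying `refl` makes the type checker evaluate the decision procedure.
witness : {A : Set} (a? : Dec A) → does a? ≡ true → A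
witness (yes a) _ = a

abstract
  table-valid : All (All (All Valid)) table
  table-valid = witness (All.all? (All.all? (All.all? valid?)) table) refl

  -- This settles 34 · 42 · 54 boxes. The tail for length 1 starts at 34, where already a single 6
  -- and a single 18 give order 37, which is coprime to 6; on this tail no box is discarded, so each
  -- one needs a certificate with a cut of gain 1.
  table-covered : Covered table (ranges 33 1) (ranges 36 6) (ranges 36 18)
  table-covered = witness (covered? table (ranges 33 1) (ranges 36 6) (ranges 36 18)) refl

theorem5p3 : (v : ℕ) → 0 < v → v ≢ 47 → v ≢ 49 → v ≢ 59 →
    (L : List ℕ) → StronglyAdmissible v L → SupportIs3 L 1 6 18 →
    Realizable v L
theorem5p3 v@(suc _) _ _ _ _ L (size , bounds , coprime) (only , 1∈ , 6∈ , 18∈) =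
  growable⇒realizable (subst (λ n → Growable n [] L) w≡v growable-L) (All.tabulate small)
  where
  L↭ : L ↭ multi (count 1 L) (count 6 L) (count 18 L)
  L↭ = ↭-multi (All.tabulate (only _))
  v≡ : v ≡ suc (count 1 L + (count 6 L + count 18 L))
  v≡ = cong suc (trans (sym size) (trans (↭-length L↭) (length-multi (count 1 L) (count 6 L) (count 18 L))))
  -- A common divisor of `v` and 6 divides their gcd, which is 1 because 6 belongs to `L`.
  ∤v : ∀ {k} → k ∣ 6 → k ≢ 1 → ¬ (k ∣ suc (count 1 L + (count 6 L + count 18 L)))
  ∤v {k} k∣6 k≢1 k∣ = k≢1 (∣1⇒≡1 (subst (k ∣_) (coprime 6 6∈) (gcd-greatest (subst (k ∣_) (sym v≡) k∣) k∣6)))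
  grown : ∃ λ w → Growable w [] (multi (count 1 L) (count 6 L) (count 18 L))
  grown = growable-multi table-valid table-covered
    (ranges-cover 33 1 _ (count-∈ 1∈)) (ranges-cover 36 6 _ (count-∈ 6∈)) (ranges-cover 36 18 _ (count-∈ 18∈))
    -- Since 18 belongs to `L`, 18 ≤ v / 2, and doubling gives the bound.
    (subst (36 ≤_) v≡ (≤-trans (*-monoˡ-≤ 2 (proj₂ (bounds 18 18∈))) (m/n*n≤m v 2)))
    (∤v (divides 3 refl) λ ()) (∤v (divides 2 refl) λ ())
  growable-L : Growable (proj₁ grown) [] L
  growable-L = growable-↭ (↭-sym L↭) (proj₂ grown)
  -- The order of the grown walk was left open; like `v`, it is one more than the size of `L`.
  w≡v : proj₁ grown ≡ v
  w≡v = trans (sym (growable-size growable-L)) (cong suc size)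
  small : ∀ {z} → z ∈ L → z + z ≤ v
  small {z} z∈ = begin
    z + z       ≡⟨ cong (z +_) (+-identityʳ z) ⟨
    2 * z       ≡⟨ *-comm 2 z ⟩
    z * 2       ≤⟨ *-monoˡ-≤ 2 (proj₂ (bounds z z∈)) ⟩
    v / 2 * 2   ≤⟨ m/n*n≤m v 2 ⟩
    v           ∎
    where open ≤-Reasoning
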